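{- Let $q$ be a prime power, let $n,t,s,\ell$ be positive integers with $\gcd(s,n)=1$ and $1\le\ell\le t-1$, and let $\sigma\colon x\mapsto x^{q^s}$, an automorphism of $\mathbb{F}_{q^{nt}}$ (whose restriction generates $\mathrm{Gal}(\mathbb{F}_{q^n}\colon\mathbb{F}_q)$). Let $a,b\in\mathbb{F}_{q^{nt}}$ with $a,b\ne0$ and \[ f(x)=-x+ax^{\sigma}+bx^{\sigma q^{\ell n}}. \] Then $\dim_{\mathbb{F}_q}\ker f\le t$. Moreover, if $t\le n\ell+s$ and at least one of the following conditions holds: 1. $s+h\ell\not\equiv0\pmod t$ for each $0\le h\le n$; 2. $j\ell\not\equiv0\pmod t$ for each $1\le j\le n$, and $s\not\equiv0\pmod t$; 3. $\ell n\not\equiv i\ell\pmod t$ for each $0\le i\le n-1$, and $s+\ell n\not\equiv0\pmod t$; then \[ \dim_{\mathbb{F}_q}\ker f\le\min\{t-1,(n-1)\ell+s\}. \]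
   Context: Notation: $x^{\sigma q^{\ell n}}:=x^{q^{s+\ell n}}$. $f$ is regarded as an $\mathbb{F}_q$-linear map $\mathbb{F}_{q^{nt}}\to\mathbb{F}_{q^{nt}}$; $\ker f$ is its set of roots in $\mathbb{F}_{q^{nt}}$. -}

module Defs where

open import Level using (Level; _⊔_; suc)
open import Algebra.Bundles using (CommutativeRing; Ring)
open import Algebra.Module.Bundles using (LeftModule)
open import Algebra.Morphism.Structures using (module RingMorphisms)
import Algebra.Definitions.RawMonoid as RawMonoidDefs
import Algebra.Properties.AbelianGroup as AbelianGroupProperties
import Algebra.Properties.Group as GroupProperties
import Algebra.Properties.Semiring.Exp as Exp
open import Data.Fin.Base using (Fin; zero) renaming (suc to fsuc)
import Data.Fin.Properties as Fin
open import Data.List.Base using (List; []; _∷_; allFin)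
open import Data.List.Membership.Propositional using (_∈_)
open import Data.List.Membership.Propositional.Properties using (∈-allFin)
open import Data.List.Relation.Unary.Any using (here; there)
open import Data.Nat.Base as ℕ using (ℕ; ∣_-_∣)
open import Data.Nat.Divisibility using (_∣_)
open import Data.Nat.Primality using (Prime)
open import Data.Product.Base using (Σ-syntax; ∃; ∃-syntax; _×_; _,_; proj₂)
open import Data.Vec.Functional as Vector using (Vector)
open import Function.Base using (_∘_)
open import Function.Bundles using (Inverse)
open import Relation.Binary.Definitions using () renaming (Decidable to Decidable₂)
import Relation.Binary.Reasoning.Setoid as SetoidReasoning
open import Relation.Binary.PropositionalEquality as ≡ using (_≡_)
open import Relation.Nullary using (¬_; Dec; yes; no; contradiction)
import Relation.Nullary.Decidable as Dec
open import Relation.Unary using (Pred; Decidable)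

IsPrimePower : ℕ → Set
IsPrimePower q = ∃[ p ] ∃[ e ] (Prime p × 1 ℕ.≤ e × q ≡ p ℕ.^ e)

infix 4 _≡_[mod_]

_≡_[mod_] : ℕ → ℕ → ℕ → Set
i ≡ j [mod m ] = m ∣ ∣ i - j ∣

record FiniteField (c ℓ : Level) (q : ℕ) : Set (suc (c ⊔ ℓ)) where
  field
    commutativeRing : CommutativeRing c ℓ

  open CommutativeRing commutativeRing public

  field
    0≉1         : ¬ (0# ≈ 1#)
    invertible  : ∀ x → ¬ (x ≈ 0#) → ∃[ y ] x * y ≈ 1#
    enumeration : Inverse setoid (≡.setoid (Fin q))

  open Exp semiring public using (_^_)

  open Inverse enumeration using (to; to-cong; from; from-cong; strictlyInverseʳ)

  infix 4 _≟_

  _≟_ : Decidable₂ _≈_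
  x ≟ y = Dec.map′
    (λ eq → trans (sym (strictlyInverseʳ x))
              (trans (from-cong eq) (strictlyInverseʳ y)))
    to-cong (to x Fin.≟ to y)

-- A ring homomorphism between fields is injective, so this is an inclusion of
-- F as a subfield of K.
record Embedding {c₁ ℓ₁ c₂ ℓ₂ q r}
                 (F : FiniteField c₁ ℓ₁ q) (K : FiniteField c₂ ℓ₂ r)
                 : Set (c₁ ⊔ ℓ₁ ⊔ c₂ ⊔ ℓ₂) where
  private
    module F = FiniteField F
    module K = FiniteField K

  field
    ι                  : F.Carrier → K.Carrier
    isRingHomomorphism : RingMorphisms.IsRingHomomorphism F.rawRing K.rawRing ι

  open RingMorphisms.IsRingHomomorphism isRingHomomorphism

  leftModule : LeftModule F.ring c₂ ℓ₂
  leftModule = record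
    { Carrierᴹ     = K.Carrier
    ; _≈ᴹ_         = K._≈_
    ; _+ᴹ_         = K._+_
    ; _*ₗ_         = λ c x → ι c K.* x
    ; 0ᴹ           = K.0#
    ; -ᴹ_          = K.-_
    ; isLeftModule = record
      { isLeftSemimodule = record
        { +ᴹ-isCommutativeMonoid = K.+-isCommutativeMonoid
        ; isPreleftSemimodule    = record
          { *ₗ-cong      = λ c≈d x≈y → K.*-cong (⟦⟧-cong c≈d) x≈y
          ; *ₗ-zeroˡ     = λ x → K.trans (K.*-congʳ 0#-homo) (K.zeroˡ x)
          ; *ₗ-distribʳ  = λ x c d →
              K.trans (K.*-congʳ (+-homo c d)) (K.distribʳ x (ι c) (ι d))
          ; *ₗ-identityˡ = λ x → K.trans (K.*-congʳ 1#-homo) (K.*-identityˡ x)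
          ; *ₗ-assoc     = λ c d x →
              K.trans (K.*-congʳ (*-homo c d)) (K.*-assoc (ι c) (ι d) x)
          ; *ₗ-zeroʳ     = λ c → K.zeroʳ (ι c)
          ; *ₗ-distribˡ  = λ c x y → K.distribˡ (ι c) x y
          }
        }
      ; -ᴹ‿cong    = K.-‿cong
      ; -ᴹ‿inverse = K.-‿inverse
      }
    }

module _ {r ℓr m ℓm} {R : Ring r ℓr} (M : LeftModule R m ℓm) where
  private module R = Ring R
  open LeftModule M

  linearCombination : ∀ {n} → Vector R.Carrier n → Vector Carrierᴹ n → Carrierᴹ
  linearCombination c v = RawMonoidDefs.sum +ᴹ-rawMonoid (λ i → c i *ₗ v i)

  LinearlyIndependent : ∀ {n} → Vector Carrierᴹ n → Set (r ⊔ ℓr ⊔ ℓm)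
  LinearlyIndependent v =
    ∀ c → linearCombination c v ≈ᴹ 0ᴹ → ∀ i → c i R.≈ R.0#

  InSpan : ∀ {n} → Vector Carrierᴹ n → Carrierᴹ → Set (r ⊔ ℓm)
  InSpan v x = ∃[ c ] linearCombination c v ≈ᴹ x

  record IsBasis {w n} (W : Pred Carrierᴹ w) (v : Vector Carrierᴹ n)
                 : Set (r ⊔ ℓr ⊔ m ⊔ ℓm ⊔ w) where
    field
      members     : ∀ i → W (v i)
      independent : LinearlyIndependent v
      spanning    : ∀ x → W x → InSpan v x

  HasDimension : ∀ {w} → Pred Carrierᴹ w → ℕ → Set (r ⊔ ℓr ⊔ m ⊔ ℓm ⊔ w)
  HasDimension W d = Σ[ v ∈ Vector Carrierᴹ d ] IsBasis W v

module _ {c ℓ N} (K : FiniteField c ℓ N) where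
  open FiniteField K

  Ker : (Carrier → Carrier) → Pred Carrier ℓ
  Ker f x = f x ≈ 0#

  -- x^σ is x ^ q^s, and x^(σ q^(l n)) is x ^ q^(s + l n).
  trinomial : (q n s l : ℕ) (a b : Carrier) → Carrier → Carrier
  trinomial q n s l a b x =
    - x + a * x ^ (q ℕ.^ s) + b * x ^ (q ℕ.^ (s ℕ.+ l ℕ.* n))

-- The kernel of a congruent map always has a dimension, so a bound on every d
-- with HasDimension (Ker f) d is not vacuous.
module _ {c₁ ℓ₁ c₂ ℓ₂ q r}
         {F : FiniteField c₁ ℓ₁ q} {K : FiniteField c₂ ℓ₂ r}
         (e : Embedding F K) where
  private
    module F = FiniteField F
    module K = FiniteField K
    M = Embedding.leftModule e
  open LeftModule M
  open SetoidReasoning ≈ᴹ-setoid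
  open Inverse F.enumeration using ()
    renaming (to to toF; from to fromF; strictlyInverseʳ to invF)
  open Inverse K.enumeration using ()
    renaming (to to toK; from to fromK; strictlyInverseʳ to invK)
  private
    module G = AbelianGroupProperties +ᴹ-abelianGroup
    module H = GroupProperties +ᴹ-group

    lc : ∀ {n} → Vector F.Carrier n → Vector Carrierᴹ n → Carrierᴹ
    lc = linearCombination M

    lc-zero : ∀ {n} (v : Vector Carrierᴹ n) → lc (λ _ → F.0#) v ≈ᴹ 0ᴹ
    lc-zero {ℕ.zero}  v = ≈ᴹ-refl
    lc-zero {ℕ.suc n} v = begin
      F.0# *ₗ v zero +ᴹ lc (λ _ → F.0#) (v ∘ fsuc)
        ≈⟨ +ᴹ-cong (*ₗ-zeroˡ _) (lc-zero (v ∘ fsuc)) ⟩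
      0ᴹ +ᴹ 0ᴹ  ≈⟨ +ᴹ-identityˡ 0ᴹ ⟩
      0ᴹ        ∎

    lc-scale : ∀ {n} a (c : Vector F.Carrier n) v →
               lc (λ i → a F.* c i) v ≈ᴹ a *ₗ lc c v
    lc-scale {ℕ.zero}  a c v = ≈ᴹ-sym (*ₗ-zeroʳ a)
    lc-scale {ℕ.suc n} a c v = begin
      (a F.* c zero) *ₗ v zero +ᴹ lc (λ i → a F.* c (fsuc i)) (v ∘ fsuc)
        ≈⟨ +ᴹ-cong (*ₗ-assoc a _ _) (lc-scale a (c ∘ fsuc) (v ∘ fsuc)) ⟩
      a *ₗ (c zero *ₗ v zero) +ᴹ a *ₗ lc (c ∘ fsuc) (v ∘ fsuc)
        ≈⟨ *ₗ-distribˡ a _ _ ⟨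
      a *ₗ lc c v ∎

    -- a x + s = 0 and b a = 1 give (- b) s = x
    solve : ∀ {a b x s} → a F.* b F.≈ F.1# → a *ₗ x +ᴹ s ≈ᴹ 0ᴹ →
            (F.- b) *ₗ s ≈ᴹ x
    solve {a} {b} {x} {s} ab≈1 eq = H.∙-cancelʳ (b *ₗ s) _ _ (begin
      (F.- b) *ₗ s +ᴹ b *ₗ s ≈⟨ *ₗ-distribʳ s (F.- b) b ⟨
      (F.- b F.+ b) *ₗ s     ≈⟨ *ₗ-cong (F.-‿inverseˡ b) ≈ᴹ-refl ⟩
      F.0# *ₗ s              ≈⟨ *ₗ-zeroˡ s ⟩
      0ᴹ                     ≈⟨ *ₗ-zeroʳ b ⟨
      b *ₗ 0ᴹ                ≈⟨ *ₗ-cong F.refl eq ⟨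
      b *ₗ (a *ₗ x +ᴹ s)     ≈⟨ *ₗ-distribˡ b _ s ⟩
      b *ₗ (a *ₗ x) +ᴹ b *ₗ s
        ≈⟨ +ᴹ-cong (≈ᴹ-sym (*ₗ-assoc b a x)) ≈ᴹ-refl ⟩
      (b F.* a) *ₗ x +ᴹ b *ₗ s
        ≈⟨ +ᴹ-cong (*ₗ-cong (F.trans (F.*-comm b a) ab≈1) ≈ᴹ-refl) ≈ᴹ-refl ⟩
      F.1# *ₗ x +ᴹ b *ₗ s    ≈⟨ +ᴹ-cong (*ₗ-identityˡ x) ≈ᴹ-refl ⟩
      x +ᴹ b *ₗ s            ∎)

    inSpan? : ∀ {n} (v : Vector Carrierᴹ n) → Decidable (InSpan M v)
    inSpan? {ℕ.zero} v x =
      Dec.map′ (λ eq → (λ ()) , eq) proj₂ (0ᴹ K.≟ x)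
    inSpan? {ℕ.suc n} v x = Dec.map′ fwd bwd
      (Fin.any? λ i → inSpan? (v ∘ fsuc) (x +ᴹ (-ᴹ (fromF i *ₗ v zero))))
      where
      fwd : ∃[ i ] InSpan M (v ∘ fsuc) (x +ᴹ (-ᴹ (fromF i *ₗ v zero))) →
            InSpan M v x
      fwd (i , c , eq) = fromF i Vector.∷ c , (begin
        fromF i *ₗ v zero +ᴹ lc c (v ∘ fsuc) ≈⟨ +ᴹ-cong ≈ᴹ-refl eq ⟩
        fromF i *ₗ v zero +ᴹ (x +ᴹ (-ᴹ (fromF i *ₗ v zero)))
          ≈⟨ ≈ᴹ-sym (+ᴹ-assoc _ _ _) ⟩
        fromF i *ₗ v zero +ᴹ x +ᴹ (-ᴹ (fromF i *ₗ v zero))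
          ≈⟨ G.xyx⁻¹≈y _ _ ⟩
        x ∎)
      bwd : InSpan M v x →
            ∃[ i ] InSpan M (v ∘ fsuc) (x +ᴹ (-ᴹ (fromF i *ₗ v zero)))
      bwd (c , eq) = toF (c zero) , c ∘ fsuc , (begin
        lc (c ∘ fsuc) (v ∘ fsuc)
          ≈⟨ G.xyx⁻¹≈y (c zero *ₗ v zero) _ ⟨
        lc c v +ᴹ (-ᴹ (c zero *ₗ v zero))
          ≈⟨ +ᴹ-cong eq (-ᴹ‿cong (*ₗ-cong (F.sym (invF (c zero))) ≈ᴹ-refl)) ⟩
        x +ᴹ (-ᴹ (fromF (toF (c zero)) *ₗ v zero)) ∎)

    extend : ∀ {n x} {v : Vector Carrierᴹ n} → ¬ InSpan M v x →
             LinearlyIndependent M v → LinearlyIndependent M (x Vector.∷ v)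
    extend {x = x} {v} x∉ ind c eq = go (c zero F.≟ F.0#)
      where
      go : Dec (c zero F.≈ F.0#) → ∀ i → c i F.≈ F.0#
      go (yes c₀≈0) zero     = c₀≈0
      go (yes c₀≈0) (fsuc i) = ind (c ∘ fsuc) (begin
        lc (c ∘ fsuc) v                ≈⟨ +ᴹ-identityˡ _ ⟨
        0ᴹ +ᴹ lc (c ∘ fsuc) v          ≈⟨ +ᴹ-cong (*ₗ-zeroˡ x) ≈ᴹ-refl ⟨
        F.0# *ₗ x +ᴹ lc (c ∘ fsuc) v
          ≈⟨ +ᴹ-cong (*ₗ-cong c₀≈0 ≈ᴹ-refl) ≈ᴹ-refl ⟨
        c zero *ₗ x +ᴹ lc (c ∘ fsuc) v ≈⟨ eq ⟩
        0ᴹ                             ∎) i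
      go (no c₀≉0) with F.invertible (c zero) c₀≉0
      ... | b , c₀b≈1 = contradiction
        ((λ i → F.- b F.* c (fsuc i)) ,
          ≈ᴹ-trans (lc-scale (F.- b) (c ∘ fsuc) v) (solve c₀b≈1 eq))
        x∉

    greedy : ∀ {w} {W : Pred Carrierᴹ w} → Decidable W → (is : List (Fin r)) →
             ∃[ d ] Σ[ v ∈ Vector Carrierᴹ d ]
               (∀ i → W (v i)) × LinearlyIndependent M v ×
               (∀ {i} → i ∈ is → W (fromK i) → InSpan M v (fromK i))
    greedy W? [] = 0 , (λ ()) , (λ ()) , (λ _ _ ()) , λ ()
    greedy {W = W} W? (i ∷ is)
      with greedy W? is | W? (fromK i)
    ... | d , v , mem , ind , span | no i∉W = d , v , mem , ind , λ
        { (here ≡.refl) i∈W → contradiction i∈W i∉W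
        ; (there j∈is)  j∈W → span j∈is j∈W }
    ... | d , v , mem , ind , span | yes i∈W with inSpan? v (fromK i)
    ...   | yes i∈⟨v⟩ = d , v , mem , ind , λ
        { (here ≡.refl) _   → i∈⟨v⟩
        ; (there j∈is)  j∈W → span j∈is j∈W }
    ...   | no i∉⟨v⟩ = ℕ.suc d , fromK i Vector.∷ v
        , (λ { zero → i∈W ; (fsuc j) → mem j })
        , extend i∉⟨v⟩ ind
        , λ { (here ≡.refl) _   → (F.1# Vector.∷ λ _ → F.0#) , (begin
                F.1# *ₗ fromK i +ᴹ lc (λ _ → F.0#) v
                  ≈⟨ +ᴹ-cong (*ₗ-identityˡ _) (lc-zero v) ⟩
                fromK i +ᴹ 0ᴹ ≈⟨ +ᴹ-identityʳ _ ⟩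
                fromK i       ∎)
            ; (there j∈is) j∈W → let (c , eq) = span j∈is j∈W in
                (F.0# Vector.∷ c)
                , ≈ᴹ-trans (+ᴹ-cong (*ₗ-zeroˡ _) ≈ᴹ-refl)
                           (≈ᴹ-trans (+ᴹ-identityˡ _) eq) }

  Ker-hasDimension : (f : K.Carrier → K.Carrier) →
                     (∀ {x y} → x K.≈ y → f x K.≈ f y) →
                     ∃ (HasDimension M (Ker K f))
  Ker-hasDimension f f-cong
    with greedy {W = Ker K f} (λ x → f x K.≟ K.0#) (allFin r)
  ... | d , v , mem , ind , span = d , v , record
    { members     = mem
    ; independent = ind
    ; spanning    = λ x x∈W →
        let (c , eq) = span (∈-allFin (toK x))
                            (K.trans (f-cong (invK x)) x∈W)
        in c , K.trans eq (invK x)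
    }

module Submission where

-- Write T x = a x^σ + b x^(σ q^(l n)), so that ker f is the set of fixed points of T.
-- T is σ-semilinear over the field of elements fixed by x ↦ x^(q^n), so by Artin's
-- argument fixed points of T that are independent over F_q are independent over that
-- field.  By division in the skew polynomial ring, a polynomial in φ = (x ↦ x^(q^n)) of
-- φ-degree less than d that vanishes at d such vectors is zero.  For φ^t - 1 this gives
-- d ≤ t.  For the second bound take T^n - 1, whose terms have φ-exponents 0 and s + h l
-- (0 ≤ h ≤ n); reduced mod t these are at most min(t - 1, (n - 1) l + s), and each of
-- the three conditions makes one term with nonzero coefficient uncancellable.

open import Defs
import Algebra.Properties.CommutativeMonoid.Sum as MonoidSum
import Algebra.Properties.CommutativeSemiring.Binomial as Binomial
import Algebra.Properties.CommutativeSemiring.Exp as CommExp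
import Algebra.Properties.Group as GroupProperties
import Algebra.Properties.Ring as RingProperties
import Algebra.Properties.Semiring.Mult as SemiringMult
import Algebra.Properties.Semiring.Sum as SemiringSum
import Algebra.Solver.Ring.NaturalCoefficients.Default as SemiringSolver
open import Algebra.Bundles using (CommutativeMonoid; CommutativeRing)
open import Algebra.Morphism.Structures using (module RingMorphisms)
open import Data.Fin as Fin using (Fin; toℕ; fromℕ; inject₁)
import Data.Fin.Permutation as Perm
import Data.Fin.Properties as Fin
open import Data.Nat
  using (ℕ; zero; suc; _+_; _*_; _∸_; _^_; _⊓_; _≤_; _<_; z≤n; s≤s; _<?_;
         NonZero; ∣_-_∣; nonTrivial⇒n>1)
open import Data.Nat.Combinatorics using (_C_; nC1≡n; nCn≡1; nCk+nC[k+1]≡[n+1]C[k+1])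
open import Data.Nat.Coprimality using (gcd≡1⇒coprime; coprime-Bézout)
open import Data.Nat.Divisibility using (_∣_; divides; ∣⇒≤; m∣m*n; m%n≡0⇒n∣m)
open import Data.Nat.DivMod
  using (_/_; _%_; m≡m%n+[m/n]*n; m%n<n; m%n≤m; m≤n⇒[n∸m]%m≡n%m)
open import Data.Nat.GCD using (gcd; module Bézout)
open import Data.Nat.Primality using (Prime; euclidsLemma; prime⇒nonTrivial; prime⇒nonZero)
import Data.Nat.Properties as ℕ
open import Data.Nat.Tactic.RingSolver using (solve-∀)
open import Data.Product using (_×_; ∃-syntax; _,_; proj₁; proj₂)
open import Data.Sum using (_⊎_; inj₁; inj₂)
open import Data.Vec using (Vec; []; _∷_)
open import Data.Vec.Functional as Vector using (Vector)
open import Data.Vec.Relation.Unary.All using (All; []; _∷_)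
open import Function using (_∘_)
open import Function.Bundles using (Inverse)
open import Level using (_⊔_)
import Relation.Binary.Reasoning.Setoid as SetoidReasoning
open import Relation.Binary.PropositionalEquality as ≡ using (_≡_; _≢_)
open import Relation.Nullary using (¬_; Dec; yes; no; contradiction)

-- For n > 1 the map T is not a polynomial in φ, because s is prime to n. Its n-th iterate is one:
-- the q-exponents n s + h l n are n (s + h l). This is why the power n is taken and why the
-- φ-exponents are s + h l. Independence over the fixed field of φ is needed because φ-polynomials
-- are linear over that field, not only over F_q; the count is then made in φ-degree, and so against
-- t instead of n t. Coprimality of s and n enters in the descent: a coefficient fixed by both x ↦
-- x^(q^s) and x ↦ x^(q^n) is fixed by x ↦ x^q. That such an element comes from F is an ordinary
-- root count for x^q - x, and it shares its division step with the count for φ-polynomials.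

-- Binomial coefficients modulo a prime.

-- The absorption identity in division-free form, so that Euclid's lemma applies to its left side;
-- it follows from Pascal's rule by induction.
[k+1]*[n+1]C[k+1]≡[n+1]*nCk : ∀ n k → suc k * (suc n C suc k) ≡ suc n * (n C k)
[k+1]*[n+1]C[k+1]≡[n+1]*nCk n zero = begin
  1 * (suc n C 1)   ≡⟨ ℕ.*-identityˡ _ ⟩
  suc n C 1         ≡⟨ nC1≡n (suc n) ⟩
  suc n             ≡⟨ ℕ.*-identityʳ (suc n) ⟨
  suc n * 1         ∎
  where open ≡.≡-Reasoning
[k+1]*[n+1]C[k+1]≡[n+1]*nCk zero (suc k) = ℕ.*-zeroʳ (suc (suc k))
[k+1]*[n+1]C[k+1]≡[n+1]*nCk (suc n) (suc k) = begin
  suc (suc k) * (suc (suc n) C suc (suc k))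
    ≡⟨ ≡.cong (suc (suc k) *_) (nCk+nC[k+1]≡[n+1]C[k+1] (suc n) (suc k)) ⟨
  suc (suc k) * (A + B)
    ≡⟨ regroup (suc k) A B ⟩
  A + (suc k * A + suc (suc k) * B)
    ≡⟨ ≡.cong (A +_) (≡.cong₂ _+_ ([k+1]*[n+1]C[k+1]≡[n+1]*nCk n k)
                                   ([k+1]*[n+1]C[k+1]≡[n+1]*nCk n (suc k))) ⟩
  A + (suc n * (n C k) + suc n * (n C suc k))
    ≡⟨ ≡.cong (A +_) (ℕ.*-distribˡ-+ (suc n) (n C k) (n C suc k)) ⟨
  A + suc n * (n C k + n C suc k)
    ≡⟨ ≡.cong (λ z → A + suc n * z) (nCk+nC[k+1]≡[n+1]C[k+1] n k) ⟩
  suc (suc n) * A ∎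
  where
  open ≡.≡-Reasoning
  A = suc n C suc k
  B = suc n C suc (suc k)
  regroup : ∀ k a b → suc k * (a + b) ≡ a + (k * a + suc k * b)
  regroup = solve-∀

-- By absorption p divides (k + 1) C(p, k + 1), and it cannot divide k + 1, which lies strictly
-- between 0 and p.
prime∣pCk : ∀ {m k} → Prime (suc m) → k < m → suc m ∣ suc m C suc k
prime∣pCk {m} {k} p k<m
  with euclidsLemma (suc k) (suc m C suc k) p
         (≡.subst (suc m ∣_) (≡.sym ([k+1]*[n+1]C[k+1]≡[n+1]*nCk m k)) (m∣m*n (m C k)))
... | inj₁ p∣k = contradiction (∣⇒≤ p∣k) (ℕ.<⇒≱ (s≤s k<m))
... | inj₂ p∣C = p∣C

module _ {c ℓ} (M : CommutativeMonoid c ℓ) where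
  open CommutativeMonoid M
  open MonoidSum M

  sum-concentrated : ∀ {n} (t : Vector Carrier n) i → (∀ j → j ≢ i → t j ≈ ε) → sum t ≈ t i
  sum-concentrated {suc n} t i t≈ε = begin
    sum t                                    ≈⟨ sum-remove {i = i} t ⟩
    t i ∙ sum (t ∘ Fin.punchIn i)
      ≈⟨ ∙-congˡ (sum-cong-≋ (λ j → t≈ε _ (Fin.punchInᵢ≢i i j))) ⟩
    t i ∙ sum {n} (λ _ → ε)                  ≈⟨ ∙-congˡ (sum-replicate-zero n) ⟩
    t i ∙ ε                                  ≈⟨ identityʳ _ ⟩
    t i                                      ∎
    where open SetoidReasoning setoid

-- Finite fields: characteristic, x^N = x, additivity of Frobenius powers.

module FiniteFieldProperties {c ℓ N} (K : FiniteField c ℓ N) where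
  open FiniteField K
    renaming (_+_ to infixl 6 _⊕_; _*_ to infixl 7 _⊛_; _^_ to infixr 8 _↑_)
  open Inverse enumeration using (to; from; to-cong; strictlyInverseˡ; strictlyInverseʳ)
  open SetoidReasoning setoid
  open CommExp commutativeSemiring using (^-congˡ; ^-assocʳ; ^-distrib-*)
  private
    module +G = GroupProperties +-group
    module Σ = SemiringSum semiring
    module Π = MonoidSum *-commutativeMonoid
    module × = SemiringMult semiring

  PowersAdditive : ℕ → Set (c ⊔ ℓ)
  PowersAdditive q = ∀ k x y → (x ⊕ y) ↑ (q ^ k) ≈ x ↑ (q ^ k) ⊕ y ↑ (q ^ k)

  x≉0∧xy≈0⇒y≈0 : ∀ {x y} → ¬ x ≈ 0# → x ⊛ y ≈ 0# → y ≈ 0#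
  x≉0∧xy≈0⇒y≈0 {x} {y} x≉0 xy≈0 with invertible x x≉0
  ... | u , xu≈1 = begin
    y            ≈⟨ *-identityˡ y ⟨
    1# ⊛ y       ≈⟨ *-congʳ (trans (*-comm u x) xu≈1) ⟨
    u ⊛ x ⊛ y    ≈⟨ *-assoc u x y ⟩
    u ⊛ (x ⊛ y)  ≈⟨ *-congˡ xy≈0 ⟩
    u ⊛ 0#       ≈⟨ zeroʳ u ⟩
    0#           ∎

  *-nonzero : ∀ {x y} → ¬ x ≈ 0# → ¬ y ≈ 0# → ¬ x ⊛ y ≈ 0#
  *-nonzero x≉0 y≉0 xy≈0 = y≉0 (x≉0∧xy≈0⇒y≈0 x≉0 xy≈0)

  *-cancelʳ-≉0 : ∀ {x y z} → ¬ z ≈ 0# → x ⊛ z ≈ y ⊛ z → x ≈ y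
  *-cancelʳ-≉0 {x} {y} {z} z≉0 eq = +G.x∙y⁻¹≈ε⇒x≈y x y (x≉0∧xy≈0⇒y≈0 z≉0 (begin
    z ⊛ (x ⊕ - y)          ≈⟨ *-comm z _ ⟩
    (x ⊕ - y) ⊛ z          ≈⟨ RingProperties.[y-z]x≈yx-zx ring z x y ⟩
    x ⊛ z ⊕ - (y ⊛ z)      ≈⟨ +G.x≈y⇒x∙y⁻¹≈ε eq ⟩
    0#                     ∎))

  product-nonzero : ∀ {n} (v : Vector Carrier n) → (∀ i → ¬ v i ≈ 0#) → ¬ Π.sum v ≈ 0#
  product-nonzero {zero}  v v≉0 1≈0 = 0≉1 (sym 1≈0)
  product-nonzero {suc n} v v≉0 =
    *-nonzero (v≉0 Fin.zero) (product-nonzero (v ∘ Fin.suc) (v≉0 ∘ Fin.suc))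

  ^-nonzero : ∀ n {x} → ¬ x ≈ 0# → ¬ x ↑ n ≈ 0#
  ^-nonzero zero    x≉0 1≈0 = 0≉1 (sym 1≈0)
  ^-nonzero (suc n) x≉0     = *-nonzero x≉0 (^-nonzero n x≉0)

  module _ {a b} (M : CommutativeMonoid a b) where
    private module M = CommutativeMonoid M
    open MonoidSum M using (sum; sum-permute; sum-cong-≋)

    -- Conjugating the bijection `g` by the enumeration permutes the indices. The monoid is
    -- arbitrary because translations are needed for sums and scalings for products.
    sum-reindex : (f : Carrier → M.Carrier) → (∀ {x y} → x ≈ y → f x M.≈ f y) →
                  (g g⁻¹ : Carrier → Carrier) →
                  (∀ {x y} → x ≈ y → g x ≈ g y) → (∀ {x y} → x ≈ y → g⁻¹ x ≈ g⁻¹ y) →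
                  (∀ x → g (g⁻¹ x) ≈ x) → (∀ x → g⁻¹ (g x) ≈ x) →
                  sum (f ∘ from) M.≈ sum (f ∘ g ∘ from)
    sum-reindex f f-cong g g⁻¹ g-cong g⁻¹-cong gg⁻¹ g⁻¹g =
      M.trans (sum-permute (f ∘ from) π)
        (sum-cong-≋ {n = N} λ i → f-cong (strictlyInverseʳ (g (from i))))
      where
      cancel : (h k : Carrier → Carrier) → (∀ {x y} → x ≈ y → h x ≈ h y) →
               (∀ x → h (k x) ≈ x) → ∀ i → to (h (from (to (k (from i))))) ≡ i
      cancel h k h-cong hk i =
        ≡.trans (to-cong (trans (h-cong (strictlyInverseʳ _)) (hk _))) (strictlyInverseˡ i)
      π : Perm.Permutation N N
      π = Perm.permutation (to ∘ g ∘ from) (to ∘ g⁻¹ ∘ from)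
            (cancel g g⁻¹ g-cong gg⁻¹) (cancel g⁻¹ g g⁻¹-cong g⁻¹g)

  -- Translation by 1 permutes the field, so the sum S of all elements satisfies S = S + N 1.
  order×1≈0 : N ×.× 1# ≈ 0#
  order×1≈0 = +G.identityʳ-unique (Σ.sum from) _ (sym (begin
    Σ.sum from
      ≈⟨ sum-reindex +-commutativeMonoid (λ x → x) (λ eq → eq)
           (_⊕ 1#) (_⊕ - 1#) +-congʳ +-congʳ
           (+G.//-rightDividesˡ 1#) (+G.//-rightDividesʳ 1#) ⟩
    Σ.sum (λ i → from i ⊕ 1#)               ≈⟨ Σ.∑-distrib-+ from (λ _ → 1#) ⟩
    Σ.sum from ⊕ Σ.sum {N} (λ _ → 1#)       ≈⟨ +-congˡ (Σ.sum-replicate N) ⟩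
    Σ.sum from ⊕ N ×.× 1#                   ∎))

  private
    -- An inhabitant of `Fin n` certifies that the exponent is positive.
    0^order≈0 : ∀ {n} → Fin n → 0# ↑ n ≈ 0#
    0^order≈0 {suc n} _ = zeroˡ _

    [0↦_] : Carrier → (Carrier → Carrier) → Carrier → Carrier
    [0↦ c ] f y with y ≟ 0#
    ... | yes _ = c
    ... | no _  = f y

    [0↦]-zero : ∀ {c f y} → y ≈ 0# → [0↦ c ] f y ≡ c
    [0↦]-zero {y = y} y≈0 with y ≟ 0#
    ... | yes _   = ≡.refl
    ... | no y≉0 = contradiction y≈0 y≉0

    [0↦]-nonzero : ∀ {c f y} → ¬ y ≈ 0# → [0↦ c ] f y ≡ f y
    [0↦]-nonzero {y = y} y≉0 with y ≟ 0#
    ... | yes y≈0 = contradiction y≈0 y≉0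
    ... | no _    = ≡.refl

    -- P is the product of the nonzero elements; multiplication by x permutes them,
    -- so P = x^(N - 1) P.  The factor at 0 is set to 1 in P and to x in Π h, which
    -- lets the product run over the whole field and gives P x = x^N P.
    x^order≈x-nonzero : ∀ {x} → ¬ x ≈ 0# → x ↑ N ≈ x
    x^order≈x-nonzero {x} x≉0 with invertible x x≉0
    ... | u , xu≈1 = sym (*-cancelʳ-≉0 (product-nonzero (f ∘ from) (λ i → f≉0 (from i))) (begin
      x ⊛ P                                          ≈⟨ *-congʳ Πh≈x ⟨
      Π.sum (h ∘ from) ⊛ P                           ≈⟨ *-comm _ _ ⟩
      P ⊛ Π.sum (h ∘ from)
        ≈⟨ *-congʳ (sum-reindex *-commutativeMonoid f f-cong (x ⊛_) (u ⊛_) *-congˡ *-congˡ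
             (λ y → cancel xu≈1 y) (λ y → cancel (trans (*-comm u x) xu≈1) y)) ⟩
      Π.sum (λ i → f (x ⊛ from i)) ⊛ Π.sum (h ∘ from)
        ≈⟨ Π.∑-distrib-+ (λ i → f (x ⊛ from i)) (h ∘ from) ⟨
      Π.sum (λ i → f (x ⊛ from i) ⊛ h (from i))      ≈⟨ Π.sum-cong-≋ (λ i → shift (from i)) ⟩
      Π.sum (λ i → x ⊛ f (from i))                   ≈⟨ Π.∑-distrib-+ (λ _ → x) (f ∘ from) ⟩
      Π.sum {N} (λ _ → x) ⊛ P                        ≈⟨ *-congʳ (Π.sum-replicate N) ⟩
      x ↑ N ⊛ P                                      ∎))
      where
      f h : Carrier → Carrier
      f = [0↦ 1# ] (λ y → y)
      h = [0↦ x ] (λ _ → 1#)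
      P = Π.sum (f ∘ from)

      cancel : ∀ {v w} → v ⊛ w ≈ 1# → ∀ y → v ⊛ (w ⊛ y) ≈ y
      cancel vw≈1 y = trans (sym (*-assoc _ _ y)) (trans (*-congʳ vw≈1) (*-identityˡ y))

      f≉0 : ∀ y → ¬ f y ≈ 0#
      f≉0 y with y ≟ 0#
      ... | yes _   = λ 1≈0 → 0≉1 (sym 1≈0)
      ... | no y≉0 = y≉0

      f-cong : ∀ {y z} → y ≈ z → f y ≈ f z
      f-cong {y} {z} y≈z with y ≟ 0# | z ≟ 0#
      ... | yes _   | yes _   = refl
      ... | yes y≈0 | no z≉0 = contradiction (trans (sym y≈z) y≈0) z≉0
      ... | no y≉0 | yes z≈0 = contradiction (trans y≈z z≈0) y≉0
      ... | no _    | no _    = y≈z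

      shift : ∀ y → f (x ⊛ y) ⊛ h y ≈ x ⊛ f y
      shift y with y ≟ 0#
      ... | yes y≈0 = trans
        (*-congʳ (reflexive ([0↦]-zero {f = λ y → y} (trans (*-congˡ y≈0) (zeroʳ x))))) (*-comm 1# x)
      ... | no y≉0 = trans
        (*-congʳ (reflexive ([0↦]-nonzero {f = λ y → y} (*-nonzero x≉0 y≉0)))) (*-identityʳ _)

      Πh≈x : Π.sum (h ∘ from) ≈ x
      Πh≈x = trans
        (sum-concentrated *-commutativeMonoid (h ∘ from) (to 0#) λ j j≢ → reflexive
          ([0↦]-nonzero {f = λ _ → 1#} (λ j≈0 →
            j≢ (≡.trans (≡.sym (strictlyInverseˡ j)) (to-cong j≈0)))))
        (reflexive ([0↦]-zero {f = λ _ → 1#} (strictlyInverseʳ 0#)))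

  x^order≈x : ∀ x → x ↑ N ≈ x
  x^order≈x x with x ≟ 0#
  ... | no x≉0 = x^order≈x-nonzero x≉0
  ... | yes x≈0 = trans (^-congˡ N x≈0) (trans (0^order≈0 (to 0#)) (sym x≈0))

  -- p^k times 1 is the k-th power of p times 1, and there are no zero divisors.
  p^k×1≈0⇒p×1≈0 : ∀ p k → (p ^ k) ×.× 1# ≈ 0# → p ×.× 1# ≈ 0#
  p^k×1≈0⇒p×1≈0 p zero    eq = contradiction (trans (sym eq) (×.×-homo-1 1#)) 0≉1
  p^k×1≈0⇒p×1≈0 p (suc k) eq with p ×.× 1# ≟ 0#
  ... | yes p≈0 = p≈0
  ... | no p≉0 = p^k×1≈0⇒p×1≈0 p k
    (x≉0∧xy≈0⇒y≈0 p≉0 (trans (sym (×.×1-homo-* p (p ^ k))) eq))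

  n×1≈0∧n∣m⇒m×x≈0 : ∀ {n m} → n ×.× 1# ≈ 0# → n ∣ m → ∀ x → m ×.× x ≈ 0#
  n×1≈0∧n∣m⇒m×x≈0 {n} n×1≈0 (divides k ≡.refl) x = begin
    (k * n) ×.× x          ≈⟨ ×.×-congʳ (k * n) (*-identityˡ x) ⟨
    (k * n) ×.× (1# ⊛ x)   ≈⟨ ×.×-assoc-* (k * n) 1# x ⟨
    (k * n) ×.× 1# ⊛ x     ≈⟨ *-congʳ (×.×1-homo-* k n) ⟩
    k ×.× 1# ⊛ n ×.× 1# ⊛ x  ≈⟨ *-congʳ (*-congˡ n×1≈0) ⟩
    k ×.× 1# ⊛ 0# ⊛ x      ≈⟨ *-congʳ (zeroʳ _) ⟩
    0# ⊛ x                 ≈⟨ zeroˡ x ⟩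
    0#                     ∎

  freshman : ∀ {p} → Prime p → p ×.× 1# ≈ 0# → ∀ x y → (x ⊕ y) ↑ p ≈ x ↑ p ⊕ y ↑ p
  freshman {suc m} p-prime p×1≈0 x y = begin
    (x ⊕ y) ↑ suc m
      ≈⟨ B.theorem (suc m) x y ⟩
    term Fin.zero ⊕ Σ.sum (term ∘ Fin.suc)
      ≈⟨ +-cong first (Σ.sum-init-last (term ∘ Fin.suc)) ⟩
    y ↑ suc m ⊕ (Σ.sum (λ j → term (Fin.suc (inject₁ j))) ⊕ term (Fin.suc (fromℕ m)))
      ≈⟨ +-congˡ (+-cong (trans (Σ.sum-cong-≋ middle) (Σ.sum-replicate-zero m)) final) ⟩
    y ↑ suc m ⊕ (0# ⊕ x ↑ suc m)
      ≈⟨ +-congˡ (+-identityˡ _) ⟩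
    y ↑ suc m ⊕ x ↑ suc m
      ≈⟨ +-comm _ _ ⟩
    x ↑ suc m ⊕ y ↑ suc m ∎
    where
    module B = Binomial commutativeSemiring
    term = B.binomialTerm x y (suc m)

    first : term Fin.zero ≈ y ↑ suc m
    first = trans (×.×-homo-1 _) (*-identityˡ _)

    middle : ∀ j → term (Fin.suc (inject₁ j)) ≈ 0#
    middle j = n×1≈0∧n∣m⇒m×x≈0 p×1≈0 (prime∣pCk p-prime
      (≡.subst (_< m) (≡.sym (Fin.toℕ-inject₁ j)) (Fin.toℕ<n j))) _

    final : term (Fin.suc (fromℕ m)) ≈ x ↑ suc m
    final rewrite Fin.toℕ-fromℕ m | nCn≡1 (suc m) | ℕ.n∸n≡0 m =
      trans (×.×-homo-1 _) (*-identityʳ _)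

  freshman-^ : ∀ {p} → Prime p → p ×.× 1# ≈ 0# → PowersAdditive p
  freshman-^ p-prime p×1≈0 zero x y =
    trans (*-identityʳ _) (sym (+-cong (*-identityʳ x) (*-identityʳ y)))
  freshman-^ {p} p-prime p×1≈0 (suc k) x y = begin
    (x ⊕ y) ↑ (p * p ^ k)                   ≈⟨ ^-assocʳ (x ⊕ y) p (p ^ k) ⟨
    ((x ⊕ y) ↑ p) ↑ (p ^ k)                 ≈⟨ ^-congˡ (p ^ k) (freshman p-prime p×1≈0 x y) ⟩
    (x ↑ p ⊕ y ↑ p) ↑ (p ^ k)               ≈⟨ freshman-^ p-prime p×1≈0 k _ _ ⟩
    (x ↑ p) ↑ (p ^ k) ⊕ (y ↑ p) ↑ (p ^ k)   ≈⟨ +-cong (^-assocʳ x p _) (^-assocʳ y p _) ⟩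
    x ↑ (p * p ^ k) ⊕ y ↑ (p * p ^ k)       ∎

-- Linear combinations of a sequence, division and collection of like terms.

-- Coefficient vectors are listed from the highest index down, so that ev e (c ∷ p)
-- adds c * e m for p of length m.
module Combinations {c ℓ} (R : CommutativeRing c ℓ) where
  open CommutativeRing R renaming (_+_ to infixl 6 _⊕_; _*_ to infixl 7 _⊛_)
  open SemiringSum semiring using (sum; sum-cong-≋; *-distribʳ-sum; ∑-distrib-+; sum-replicate-zero)
  open SemiringSolver commutativeSemiring using (solve; _:=_; _:+_; _:*_)
  open SetoidReasoning setoid

  AllZero : ∀ {m} → Vec Carrier m → Set (c ⊔ ℓ)
  AllZero = All (_≈ 0#)

  ev : (ℕ → Carrier) → ∀ {m} → Vec Carrier m → Carrier
  ev e []              = 0#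
  ev e {suc m} (c ∷ p) = c ⊛ e m ⊕ ev e p

  ev-cong : ∀ {e e′} → (∀ j → e j ≈ e′ j) → ∀ {m} (p : Vec Carrier m) → ev e p ≈ ev e′ p
  ev-cong e≈e′ []      = refl
  ev-cong e≈e′ (c ∷ p) = +-cong (*-congˡ (e≈e′ _)) (ev-cong e≈e′ p)

  ev-scale : ∀ s e {m} (p : Vec Carrier m) → ev (λ j → s ⊛ e j) p ≈ s ⊛ ev e p
  ev-scale s e []              = sym (zeroʳ s)
  ev-scale s e {suc m} (c ∷ p) = begin
    c ⊛ (s ⊛ e m) ⊕ ev (λ j → s ⊛ e j) p  ≈⟨ +-congˡ (ev-scale s e p) ⟩
    c ⊛ (s ⊛ e m) ⊕ s ⊛ ev e p
      ≈⟨ solve 4 (λ c s x y → (c :* (s :* x) :+ s :* y) := (s :* (c :* x :+ y)))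
           refl c s (e m) (ev e p) ⟩
    s ⊛ (c ⊛ e m ⊕ ev e p)                ∎

  ev-zero : ∀ {e} → (∀ j → e j ≈ 0#) → ∀ {m} (p : Vec Carrier m) → ev e p ≈ 0#
  ev-zero {e} e≈0 p = begin
    ev e p                    ≈⟨ ev-cong (λ j → trans (e≈0 j) (sym (zeroˡ 0#))) p ⟩
    ev (λ _ → 0# ⊛ 0#) p      ≈⟨ ev-scale 0# (λ _ → 0#) p ⟩
    0# ⊛ ev (λ _ → 0#) p      ≈⟨ zeroˡ _ ⟩
    0#                        ∎

  -- Division by a monic linear factor.  For ordinary polynomials e j = x^j,
  -- e′ j = (x - r) x^j and κ j = r; for polynomials in a Frobenius power φ,
  -- e j = φ^j(x), e′ j = φ^j(φ(x) - u x) and κ j = φ^j(u).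
  division : ∀ (κ : ℕ → Carrier) {m} (p : Vec Carrier (suc m)) →
    ∃[ p′ ] ∃[ r ]
      (∀ e e′ → (∀ j → e (suc j) ≈ e′ j ⊕ κ j ⊛ e j) → ev e p ≈ ev e′ {m} p′ ⊕ r ⊛ e 0)
      × (AllZero p′ → r ≈ 0# → AllZero p)
  division κ (c ∷ []) = [] , c , (λ e e′ _ → +-comm _ _) , (λ _ c≈0 → c≈0 ∷ [])
  division κ {suc m} (c ∷ d ∷ p) with division κ ((d ⊕ c ⊛ κ m) ∷ p)
  ... | p′ , r , eq , zeros = c ∷ p′ , r , eq′ , zeros′
    where
    eq′ : ∀ e e′ → (∀ j → e (suc j) ≈ e′ j ⊕ κ j ⊛ e j) →
          ev e (c ∷ d ∷ p) ≈ ev e′ (c ∷ p′) ⊕ r ⊛ e 0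
    eq′ e e′ step = begin
      c ⊛ e (suc m) ⊕ (d ⊛ e m ⊕ ev e p)             ≈⟨ +-congʳ (*-congˡ (step m)) ⟩
      c ⊛ (e′ m ⊕ κ m ⊛ e m) ⊕ (d ⊛ e m ⊕ ev e p)
        ≈⟨ solve 6 (λ c x k y d z → (c :* (x :+ k :* y) :+ (d :* y :+ z))
                                    := (c :* x :+ ((d :+ c :* k) :* y :+ z)))
             refl c (e′ m) (κ m) (e m) d (ev e p) ⟩
      c ⊛ e′ m ⊕ ((d ⊕ c ⊛ κ m) ⊛ e m ⊕ ev e p)      ≈⟨ +-congˡ (eq e e′ step) ⟩
      c ⊛ e′ m ⊕ (ev e′ p′ ⊕ r ⊛ e 0)                ≈⟨ +-assoc _ _ _ ⟨
      c ⊛ e′ m ⊕ ev e′ p′ ⊕ r ⊛ e 0                  ∎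
    zeros′ : AllZero (c ∷ p′) → r ≈ 0# → AllZero (c ∷ d ∷ p)
    zeros′ (c≈0 ∷ p′≈0) r≈0 with zeros p′≈0 r≈0
    ... | d+cκ≈0 ∷ p≈0 = c≈0 ∷ d≈0 ∷ p≈0
      where
      d≈0 : d ≈ 0#
      d≈0 = begin
        d               ≈⟨ +-identityʳ d ⟨
        d ⊕ 0#          ≈⟨ +-congˡ (trans (*-congʳ c≈0) (zeroˡ _)) ⟨
        d ⊕ c ⊛ κ m     ≈⟨ d+cκ≈0 ⟩
        0#              ∎

  -- The Iverson bracket as a scalar.
  ⟦_⟧·_ : ∀ {a} {A : Set a} → Dec A → Carrier → Carrier
  ⟦ yes _ ⟧· x = x
  ⟦ no _  ⟧· x = 0#

  module _ {N} (γ : Fin N → Carrier) (r : Fin N → ℕ) where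

    -- Exponents may collide, as they do after reduction mod t; colliding terms are added here and
    -- may cancel.
    coefficient : ℕ → Carrier
    coefficient j = sum λ k → ⟦ r k ℕ.≟ j ⟧· γ k

    collect : ∀ m → Vec Carrier m
    collect zero    = []
    collect (suc m) = coefficient m ∷ collect m

    private
      -- Truncating the sum to exponents below `m` allows induction: the step to `suc m` admits
      -- exactly the terms of exponent `m`.
      ev-collect-< : ∀ e m →
        ev e (collect m) ≈ sum λ k → ⟦ r k <? m ⟧· (γ k ⊛ e (r k))
      ev-collect-< e zero    = sym (sum-replicate-zero N)
      ev-collect-< e (suc m) = begin
        coefficient m ⊛ e m ⊕ ev e (collect m)
          ≈⟨ +-cong (*-distribʳ-sum (e m) (λ k → ⟦ r k ℕ.≟ m ⟧· γ k)) (ev-collect-< e m) ⟩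
        sum (λ k → (⟦ r k ℕ.≟ m ⟧· γ k) ⊛ e m)
          ⊕ sum (λ k → ⟦ r k <? m ⟧· (γ k ⊛ e (r k)))
          ≈⟨ ∑-distrib-+ (λ k → (⟦ r k ℕ.≟ m ⟧· γ k) ⊛ e m) _ ⟨
        sum (λ k → (⟦ r k ℕ.≟ m ⟧· γ k) ⊛ e m
                   ⊕ (⟦ r k <? m ⟧· (γ k ⊛ e (r k))))
          ≈⟨ sum-cong-≋ {n = N} pointwise ⟩
        sum (λ k → ⟦ r k <? suc m ⟧· (γ k ⊛ e (r k))) ∎
        where
        pointwise : ∀ k → (⟦ r k ℕ.≟ m ⟧· γ k) ⊛ e m
                          ⊕ (⟦ r k <? m ⟧· (γ k ⊛ e (r k)))
                        ≈ (⟦ r k <? suc m ⟧· (γ k ⊛ e (r k)))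
        pointwise k with r k ℕ.≟ m | r k <? m | r k <? suc m
        ... | yes ≡.refl | yes r<r | _        = contradiction r<r (ℕ.n≮n _)
        ... | yes ≡.refl | no _    | yes _    = +-identityʳ _
        ... | yes ≡.refl | no _    | no r≮1+r = contradiction (ℕ.n<1+n _) r≮1+r
        ... | no _       | yes _   | yes _    = trans (+-congʳ (zeroˡ _)) (+-identityˡ _)
        ... | no _       | yes r<m | no r≮1+m = contradiction (ℕ.m<n⇒m<1+n r<m) r≮1+m
        ... | no r≢m     | no r≮m  | yes r<1+m =
          contradiction (ℕ.≤∧≢⇒< (ℕ.≤-pred r<1+m) r≢m) r≮m
        ... | no _       | no _    | no _     = trans (+-congʳ (zeroˡ _)) (+-identityˡ _)

    ev-collect : ∀ e {m} → (∀ k → r k < m) → ev e (collect m) ≈ sum λ k → γ k ⊛ e (r k)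
    ev-collect e {m} r<m = trans (ev-collect-< e m) (sum-cong-≋ {n = N} pointwise)
      where
      pointwise : ∀ k → (⟦ r k <? m ⟧· (γ k ⊛ e (r k))) ≈ γ k ⊛ e (r k)
      pointwise k with r k <? m
      ... | yes _   = refl
      ... | no r≮m = contradiction (r<m k) r≮m

    coefficient-zero : ∀ {m j} → AllZero (collect m) → j < m → coefficient j ≈ 0#
    coefficient-zero {suc m} {j} (c≈0 ∷ p≈0) j<1+m with j ℕ.≟ m
    ... | yes ≡.refl = c≈0
    ... | no j≢m     = coefficient-zero p≈0 (ℕ.≤∧≢⇒< (ℕ.≤-pred j<1+m) j≢m)

    coefficient-unique : ∀ k → (∀ k′ → k′ ≢ k → r k′ ≢ r k) → coefficient (r k) ≈ γ k
    coefficient-unique k unique = trans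
      (sum-concentrated +-commutativeMonoid _ k off) at
      where
      off : ∀ k′ → k′ ≢ k → (⟦ r k′ ℕ.≟ r k ⟧· γ k′) ≈ 0#
      off k′ k′≢k with r k′ ℕ.≟ r k
      ... | yes eq = contradiction eq (unique k′ k′≢k)
      ... | no _   = refl
      at : (⟦ r k ℕ.≟ r k ⟧· γ k) ≈ γ k
      at with r k ℕ.≟ r k
      ... | yes _  = refl
      ... | no r≢r = contradiction ≡.refl r≢r

  -- The notion from interpolation theory, with `e i j` as the value of the j-th basis function at
  -- the i-th point.
  Unisolvent : ∀ {d} → (Fin d → ℕ → Carrier) → ℕ → Set (c ⊔ ℓ)
  Unisolvent e m = ∀ p → (∀ i → ev (e i) p ≈ 0#) → AllZero {m} p

  -- A term whose exponent no other term shares survives collection unchanged, so unisolvence kills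
  -- its coefficient. Every degree contradiction below has this form.
  unique-exponent⇒zero : ∀ {d m} {e : Fin d → ℕ → Carrier} → Unisolvent e m →
    ∀ {N} (γ : Fin N → Carrier) (r : Fin N → ℕ) → (∀ k → r k < m) →
    (∀ i → sum (λ k → γ k ⊛ e i (r k)) ≈ 0#) →
    ∀ k → (∀ k′ → k′ ≢ k → r k′ ≢ r k) → γ k ≈ 0#
  unique-exponent⇒zero {e = e} unisolvent γ r r<m vanish k unique = begin
    γ k                       ≈⟨ coefficient-unique γ r k unique ⟨
    coefficient γ r (r k)
      ≈⟨ coefficient-zero γ r (unisolvent (collect γ r _)
           (λ i → trans (ev-collect γ r (e i) r<m) (vanish i))) (r<m k) ⟩
    0#                        ∎

-- Root counting for ordinary polynomials.

module RootBound {c ℓ N} (K : FiniteField c ℓ N) where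
  open FiniteField K
    renaming (_+_ to infixl 6 _⊕_; _*_ to infixl 7 _⊛_; _^_ to infixr 8 _↑_)
  open FiniteFieldProperties K
  open Combinations commutativeRing
  private module +G = GroupProperties +-group

  -- Dividing by the factor of the first point leaves a quotient that vanishes at the others, since
  -- differences of distinct points can be cancelled.
  distinct⇒unisolvent : ∀ m {d} → m ≤ d → (x : Fin d → Carrier) →
    (∀ i j → i ≢ j → ¬ x i ≈ x j) → Unisolvent (λ i → x i ↑_) m
  distinct⇒unisolvent zero    _         x distinct []  vanish = []
  distinct⇒unisolvent (suc m) (s≤s m≤d) x distinct p   vanish
    with division (λ _ → x Fin.zero) p
  ... | p′ , r , eq , zeros = zeros
    (distinct⇒unisolvent m m≤d (x ∘ Fin.suc)
      (λ i j i≢j → distinct _ _ (i≢j ∘ Fin.suc-injective)) p′ λ i →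
      x≉0∧xy≈0⇒y≈0
        (λ x-x₀≈0 → distinct (Fin.suc i) Fin.zero (λ ()) (+G.x∙y⁻¹≈ε⇒x≈y _ _ x-x₀≈0))
        (begin
          (x (Fin.suc i) ⊕ - x₀) ⊛ ev (x (Fin.suc i) ↑_) p′                  ≈⟨ +-identityʳ _ ⟨
          (x (Fin.suc i) ⊕ - x₀) ⊛ ev (x (Fin.suc i) ↑_) p′ ⊕ 0#
            ≈⟨ +-congˡ (trans (*-congʳ r≈0) (zeroˡ _)) ⟨
          (x (Fin.suc i) ⊕ - x₀) ⊛ ev (x (Fin.suc i) ↑_) p′ ⊕ r ⊛ 1#
            ≈⟨ factor (x (Fin.suc i)) ⟨
          ev (x (Fin.suc i) ↑_) p
            ≈⟨ vanish (Fin.suc i) ⟩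
          0#                                                                 ∎))
    r≈0
    where
    open SetoidReasoning setoid
    x₀ = x Fin.zero

    factor : ∀ y → ev (y ↑_) p ≈ (y ⊕ - x₀) ⊛ ev (y ↑_) p′ ⊕ r ⊛ 1#
    factor y = trans
      (eq (y ↑_) (λ j → (y ⊕ - x₀) ⊛ y ↑ j) λ j →
        trans (*-congʳ (sym (+G.//-rightDividesˡ x₀ y))) (distribʳ _ _ _))
      (+-congʳ (ev-scale (y ⊕ - x₀) (y ↑_) p′))

    r≈0 : r ≈ 0#
    r≈0 = begin
      r                                          ≈⟨ *-identityʳ r ⟨
      r ⊛ 1#                                     ≈⟨ +-identityˡ _ ⟨
      0# ⊕ r ⊛ 1#
        ≈⟨ +-congʳ (trans (*-congʳ (-‿inverseʳ x₀)) (zeroˡ _)) ⟨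
      (x₀ ⊕ - x₀) ⊛ ev (x₀ ↑_) p′ ⊕ r ⊛ 1#       ≈⟨ factor x₀ ⟨
      ev (x₀ ↑_) p                               ≈⟨ vanish Fin.zero ⟩
      0#                                         ∎

-- Frobenius powers and their fixed fields.

module Frobenius {c ℓ N} (K : FiniteField c ℓ N) (q : ℕ)
                 (additive : FiniteFieldProperties.PowersAdditive K q) where

  open FiniteField K
    renaming (_+_ to infixl 6 _⊕_; _*_ to infixl 7 _⊛_; _^_ to infixr 8 _↑_)
  open FiniteFieldProperties K
  open Combinations commutativeRing
  open CommExp commutativeSemiring using (^-congˡ; ^-congʳ; ^-assocʳ; ^-distrib-*)
  open SemiringSum semiring
    using (sum; sum-cong-≋; *-distribˡ-sum; ∑-distrib-+; sum-replicate-zero)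
  open SemiringSolver commutativeSemiring using (solve; _:=_; _:+_; _:*_)
  open SetoidReasoning setoid
  private
    module +G = GroupProperties +-group
    module R = RingProperties ring

  private
    regroup-+ : ∀ c x u v → c ⊛ (x ⊕ u ⊛ v) ≈ c ⊛ x ⊕ u ⊛ (c ⊛ v)
    regroup-+ = solve 4 (λ c x u v → c :* (x :+ u :* v) := c :* x :+ u :* (c :* v)) refl

    regroup-* : ∀ a w S b → a ⊛ w ⊛ S ⊛ b ≈ a ⊛ b ⊛ (S ⊛ w)
    regroup-* = solve 4 (λ a w S b → a :* w :* S :* b := a :* b :* (S :* w)) refl

  fr : ℕ → Carrier → Carrier
  fr k x = x ↑ (q ^ k)

  fr-cong : ∀ k {x y} → x ≈ y → fr k x ≈ fr k y
  fr-cong k = ^-congˡ (q ^ k)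

  fr-exp : ∀ {j k} x → j ≡ k → fr j x ≈ fr k x
  fr-exp x ≡.refl = refl

  fr-* : ∀ k x y → fr k (x ⊛ y) ≈ fr k x ⊛ fr k y
  fr-* k x y = ^-distrib-* x y (q ^ k)

  fr-1 : ∀ k → fr k 1# ≈ 1#
  fr-1 k = go (q ^ k)
    where
    go : ∀ n → 1# ↑ n ≈ 1#
    go zero    = refl
    go (suc n) = trans (*-identityˡ _) (go n)

  fr-0 : ∀ k → fr k 0# ≈ 0#
  fr-0 k = R.x+x≈x⇒x≈0 _ (trans (sym (additive k 0# 0#)) (fr-cong k (+-identityˡ 0#)))

  fr-neg : ∀ k x → fr k (- x) ≈ - fr k x
  fr-neg k x = +G.inverseˡ-unique _ _
    (trans (sym (additive k (- x) x)) (trans (fr-cong k (-‿inverseˡ x)) (fr-0 k)))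

  fr-sum : ∀ k {n} (v : Vector Carrier n) → fr k (sum v) ≈ sum (fr k ∘ v)
  fr-sum k {zero}  v = fr-0 k
  fr-sum k {suc n} v = trans (additive k _ _) (+-congˡ (fr-sum k (v ∘ Fin.suc)))

  fr-fr : ∀ j k x → fr k (fr j x) ≈ fr (j + k) x
  fr-fr j k x = trans (^-assocʳ x (q ^ j) (q ^ k))
    (^-congʳ x (≡.sym (ℕ.^-distribˡ-+-* q j k)))

  fr-comm : ∀ j k x → fr k (fr j x) ≈ fr j (fr k x)
  fr-comm j k x = trans (fr-fr j k x) (trans (fr-exp x (ℕ.+-comm j k)) (sym (fr-fr k j x)))

  fixed-multiple : ∀ k {x} → fr k x ≈ x → ∀ j → fr (j * k) x ≈ x
  fixed-multiple k {x} fix zero    = *-identityʳ x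
  fixed-multiple k {x} fix (suc j) = begin
    fr (k + j * k) x       ≈⟨ fr-fr k (j * k) x ⟨
    fr (j * k) (fr k x)    ≈⟨ fr-cong (j * k) fix ⟩
    fr (j * k) x           ≈⟨ fixed-multiple k fix j ⟩
    x                      ∎

  -- Bézout over the naturals reads 1 + j n = i s or 1 + i s = j n. In either case the added
  -- multiple fixes `fr 1 x`, while the total exponent fixes `x`.
  fixed-coprime : ∀ s n → gcd s n ≡ 1 → ∀ {x} → fr s x ≈ x → fr n x ≈ x → fr 1 x ≈ x
  fixed-coprime s n gcd≡1 {x} fix-s fix-n
    with coprime-Bézout (gcd≡1⇒coprime {s} {n} gcd≡1)
  ... | Bézout.+- i j eq = begin
    fr 1 x                 ≈⟨ fixed-multiple n (trans (fr-comm 1 n x) (fr-cong 1 fix-n)) j ⟨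
    fr (j * n) (fr 1 x)    ≈⟨ fr-fr 1 (j * n) x ⟩
    fr (1 + j * n) x       ≈⟨ fr-exp x eq ⟩
    fr (i * s) x           ≈⟨ fixed-multiple s fix-s i ⟩
    x                      ∎
  ... | Bézout.-+ i j eq = begin
    fr 1 x                 ≈⟨ fixed-multiple s (trans (fr-comm 1 s x) (fr-cong 1 fix-s)) i ⟨
    fr (i * s) (fr 1 x)    ≈⟨ fr-fr 1 (i * s) x ⟩
    fr (1 + i * s) x       ≈⟨ fr-exp x eq ⟩
    fr (j * n) x           ≈⟨ fixed-multiple n fix-n j ⟩
    x                      ∎

  fixed-inverse : ∀ k {x u} → x ⊛ u ≈ 1# → fr k x ≈ x → fr k u ≈ u
  fixed-inverse k {x} {u} xu≈1 fix = begin
    fr k u                     ≈⟨ *-identityˡ _ ⟨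
    1# ⊛ fr k u                ≈⟨ *-congʳ (trans (*-comm u x) xu≈1) ⟨
    u ⊛ x ⊛ fr k u             ≈⟨ *-assoc u x _ ⟩
    u ⊛ (x ⊛ fr k u)           ≈⟨ *-congˡ (*-congʳ fix) ⟨
    u ⊛ (fr k x ⊛ fr k u)      ≈⟨ *-congˡ (fr-* k x u) ⟨
    u ⊛ fr k (x ⊛ u)           ≈⟨ *-congˡ (trans (fr-cong k xu≈1) (fr-1 k)) ⟩
    u ⊛ 1#                     ≈⟨ *-identityʳ u ⟩
    u                          ∎

  -- Linear independence over the fixed field of x ↦ x^(q^n).
  FixedIndependent : ℕ → ∀ {d} → Vector Carrier d → Set (c ⊔ ℓ)
  FixedIndependent n {d} v =
    (c : Vector Carrier d) → (∀ i → fr n (c i) ≈ c i) → sum (λ i → c i ⊛ v i) ≈ 0# → ∀ i → c i ≈ 0#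

  fixedIndependent-tail : ∀ n {d} (v : Vector Carrier (suc d)) →
                          FixedIndependent n v → FixedIndependent n (v ∘ Fin.suc)
  fixedIndependent-tail n v ind c fix eq i = ind (0# Vector.∷ c)
    (λ { Fin.zero → fr-0 n ; (Fin.suc i) → fix i })
    (trans (+-congʳ (zeroˡ _)) (trans (+-identityˡ _) eq)) (Fin.suc i)

  fixedIndependent⇒head≉0 : ∀ n {d} (v : Vector Carrier (suc d)) →
                            FixedIndependent n v → ¬ v Fin.zero ≈ 0#
  fixedIndependent⇒head≉0 n {d} v ind v₀≈0 = 0≉1 (sym (ind (1# Vector.∷ λ _ → 0#)
    (λ { Fin.zero → fr-1 n ; (Fin.suc i) → fr-0 n })
    (begin
      1# ⊛ v Fin.zero ⊕ sum (λ i → 0# ⊛ v (Fin.suc i))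
        ≈⟨ +-cong (trans (*-identityˡ _) v₀≈0) (sum-cong-≋ {n = d} (λ i → zeroˡ _)) ⟩
      0# ⊕ sum {d} (λ i → 0#)  ≈⟨ +-identityˡ _ ⟩
      sum {d} (λ i → 0#)       ≈⟨ sum-replicate-zero d ⟩
      0#                       ∎)
    Fin.zero))

  -- Root counting for polynomials in φ.

  module _ (n : ℕ) where

    -- ψ is the monic q^n-polynomial of q^n-degree 1 that vanishes at v₀.
    module _ (v₀ w : Carrier) (v₀w≈1 : v₀ ⊛ w ≈ 1#) where

      private
        -- This is v₀^(q^n - 1), with `w` as the inverse of `v₀`.
        u : Carrier
        u = fr n v₀ ⊛ w

      ψ : Carrier → Carrier
      ψ x = fr n x ⊕ - (u ⊛ x)

      ψ+u : ∀ x → ψ x ⊕ u ⊛ x ≈ fr n x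
      ψ+u x = +G.//-rightDividesˡ (u ⊛ x) (fr n x)

      ψ-v₀ : ψ v₀ ≈ 0#
      ψ-v₀ = +G.x≈y⇒x∙y⁻¹≈ε (sym (trans (*-assoc _ w v₀)
        (trans (*-congˡ (trans (*-comm w v₀) v₀w≈1)) (*-identityʳ _))))

      ψ-step : ∀ x j → fr (suc j * n) x ≈ fr (j * n) (ψ x) ⊕ fr (j * n) u ⊛ fr (j * n) x
      ψ-step x j = begin
        fr (n + j * n) x                                   ≈⟨ fr-fr n (j * n) x ⟨
        fr (j * n) (fr n x)                                ≈⟨ fr-cong (j * n) (ψ+u x) ⟨
        fr (j * n) (ψ x ⊕ u ⊛ x)                           ≈⟨ additive (j * n) _ _ ⟩
        fr (j * n) (ψ x) ⊕ fr (j * n) (u ⊛ x)              ≈⟨ +-congˡ (fr-* (j * n) u x) ⟩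
        fr (j * n) (ψ x) ⊕ fr (j * n) u ⊛ fr (j * n) x     ∎

      -- For c fixed by φ, a relation among the ψ(v i) says that S = Σ c i v i is killed by ψ. Then
      -- S / v₀ is fixed by φ, so S is a fixed-field multiple of v₀, which is a relation among the
      -- original vectors.
      ψ-independent : ∀ {d} (v : Vector Carrier d) →
                      FixedIndependent n (v₀ Vector.∷ v) → FixedIndependent n (ψ ∘ v)
      ψ-independent {d} v ind c fix eq i =
        ind (- k Vector.∷ c)
          (λ { Fin.zero → trans (fr-neg n k) (-‿cong fix-k) ; (Fin.suc i) → fix i })
          relation (Fin.suc i)
        where
        S = sum (λ i → c i ⊛ v i)
        k = S ⊛ w

        fr-S : fr n S ≈ u ⊛ S
        fr-S = begin
          fr n S                                        ≈⟨ fr-sum n (λ i → c i ⊛ v i) ⟩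
          sum (λ i → fr n (c i ⊛ v i))
            ≈⟨ sum-cong-≋ {n = d} (λ i →
                trans (fr-* n _ _) (trans (*-cong (fix i) (sym (ψ+u (v i))))
                (regroup-+ (c i) (ψ (v i)) u (v i)))) ⟩
          sum (λ i → c i ⊛ ψ (v i) ⊕ u ⊛ (c i ⊛ v i))   ≈⟨ ∑-distrib-+ (λ i → c i ⊛ ψ (v i)) _ ⟩
          sum (λ i → c i ⊛ ψ (v i)) ⊕ sum (λ i → u ⊛ (c i ⊛ v i))
            ≈⟨ +-cong eq (sym (*-distribˡ-sum u (λ i → c i ⊛ v i))) ⟩
          0# ⊕ u ⊛ S                                    ≈⟨ +-identityˡ _ ⟩
          u ⊛ S                                         ∎

        fix-k : fr n k ≈ k
        fix-k = begin
          fr n (S ⊛ w)                        ≈⟨ fr-* n S w ⟩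
          fr n S ⊛ fr n w                     ≈⟨ *-congʳ fr-S ⟩
          fr n v₀ ⊛ w ⊛ S ⊛ fr n w            ≈⟨ regroup-* (fr n v₀) w S (fr n w) ⟩
          fr n v₀ ⊛ fr n w ⊛ k                ≈⟨ *-congʳ (fr-* n v₀ w) ⟨
          fr n (v₀ ⊛ w) ⊛ k                   ≈⟨ *-congʳ (trans (fr-cong n v₀w≈1) (fr-1 n)) ⟩
          1# ⊛ k                              ≈⟨ *-identityˡ k ⟩
          k                                   ∎

        relation : - k ⊛ v₀ ⊕ S ≈ 0#
        relation = begin
          - k ⊛ v₀ ⊕ S              ≈⟨ +-congˡ (*-identityʳ S) ⟨
          - k ⊛ v₀ ⊕ S ⊛ 1#         ≈⟨ +-congˡ (*-congˡ (trans (*-comm w v₀) v₀w≈1)) ⟨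
          - k ⊛ v₀ ⊕ S ⊛ (w ⊛ v₀)   ≈⟨ +-congˡ (*-assoc S w v₀) ⟨
          - k ⊛ v₀ ⊕ k ⊛ v₀         ≈⟨ distribʳ v₀ (- k) k ⟨
          (- k ⊕ k) ⊛ v₀            ≈⟨ *-congʳ (-‿inverseˡ k) ⟩
          0# ⊛ v₀                   ≈⟨ zeroˡ v₀ ⟩
          0#                        ∎

    -- The skew analogue of the root count: dividing on the right by ψ lowers the φ-degree by one,
    -- and the quotient vanishes at the images ψ(v i), which are again independent.
    independent⇒unisolvent : ∀ m {d} → m ≤ d → (v : Vector Carrier d) → FixedIndependent n v →
                             Unisolvent (λ i j → fr (j * n) (v i)) m
    independent⇒unisolvent zero    _         v ind [] vanish = []
    independent⇒unisolvent (suc m) (s≤s m≤d) v ind p  vanish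
      with invertible (v Fin.zero) (fixedIndependent⇒head≉0 n v ind)
    ... | w , v₀w≈1
      with division (λ j → fr (j * n) (fr n (v Fin.zero) ⊛ w)) p
    ... | p′ , r , eq , zeros = zeros
      (independent⇒unisolvent m m≤d (ψ₀ ∘ v ∘ Fin.suc)
        (ψ-independent v₀ w v₀w≈1 (v ∘ Fin.suc) ind′) p′ λ i → begin
          ev (λ j → fr (j * n) (ψ₀ (v (Fin.suc i)))) p′                       ≈⟨ +-identityʳ _ ⟨
          ev (λ j → fr (j * n) (ψ₀ (v (Fin.suc i)))) p′ ⊕ 0#
            ≈⟨ +-congˡ (trans (*-congʳ r≈0) (zeroˡ _)) ⟨
          ev (λ j → fr (j * n) (ψ₀ (v (Fin.suc i)))) p′ ⊕ r ⊛ fr 0 (v (Fin.suc i))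
            ≈⟨ factor (v (Fin.suc i)) ⟨
          ev (λ j → fr (j * n) (v (Fin.suc i))) p
            ≈⟨ vanish (Fin.suc i) ⟩
          0#                                                                  ∎)
      r≈0
      where
      v₀ = v Fin.zero
      ψ₀ = ψ v₀ w v₀w≈1

      -- A vector and its head put back on its tail agree only pointwise, so independence is
      -- transferred by applying it.
      ind′ : FixedIndependent n (v₀ Vector.∷ (v ∘ Fin.suc))
      ind′ c fix rel = ind c fix rel

      factor : ∀ x → ev (λ j → fr (j * n) x) p ≈ ev (λ j → fr (j * n) (ψ₀ x)) p′ ⊕ r ⊛ fr 0 x
      factor x = eq _ _ (ψ-step v₀ w v₀w≈1 x)

      r≈0 : r ≈ 0#
      r≈0 = x≉0∧xy≈0⇒y≈0 (fixedIndependent⇒head≉0 n v ind) (begin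
        v₀ ⊛ r                                             ≈⟨ *-comm v₀ r ⟩
        r ⊛ v₀                                             ≈⟨ *-congˡ (*-identityʳ v₀) ⟨
        r ⊛ fr 0 v₀                                        ≈⟨ +-identityˡ _ ⟨
        0# ⊕ r ⊛ fr 0 v₀
          ≈⟨ +-congʳ (ev-zero (λ j → trans (fr-cong (j * n) (ψ-v₀ v₀ w v₀w≈1)) (fr-0 (j * n))) p′) ⟨
        ev (λ j → fr (j * n) (ψ₀ v₀)) p′ ⊕ r ⊛ fr 0 v₀     ≈⟨ factor v₀ ⟨
        ev (λ j → fr (j * n) v₀) p                         ≈⟨ vanish Fin.zero ⟩
        0#                                                 ∎)

  -- Independence over F_q lifted to the fixed field of φ.

  -- Artin's argument: applying T to a relation whose first coefficient is 1 and
  -- subtracting leaves a shorter relation, so all its coefficients are fixed by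
  -- x ↦ x^(q^s) as well as by x ↦ x^(q^n).
  module _ (s n : ℕ) (gcd≡1 : gcd s n ≡ 1)
           (T : Carrier → Carrier)
           (T-cong : ∀ {x y} → x ≈ y → T x ≈ T y)
           (T-+ : ∀ x y → T (x ⊕ y) ≈ T x ⊕ T y)
           (T-* : ∀ {c} x → fr n c ≈ c → T (c ⊛ x) ≈ fr s c ⊛ T x) where

    T-0 : T 0# ≈ 0#
    T-0 = R.x+x≈x⇒x≈0 _ (trans (sym (T-+ 0# 0#)) (T-cong (+-identityˡ 0#)))

    T-sum : ∀ {d} (c v : Vector Carrier d) → (∀ i → fr n (c i) ≈ c i) → (∀ i → T (v i) ≈ v i) →
            T (sum (λ i → c i ⊛ v i)) ≈ sum (λ i → fr s (c i) ⊛ v i)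
    T-sum {zero}  c v fix Tv = T-0
    T-sum {suc d} c v fix Tv = trans (T-+ _ _) (+-cong
      (trans (T-* _ (fix Fin.zero)) (*-congˡ (Tv Fin.zero)))
      (T-sum (c ∘ Fin.suc) (v ∘ Fin.suc) (fix ∘ Fin.suc) (Tv ∘ Fin.suc)))

    fixedPoints-independent : ∀ {d} (v : Vector Carrier d) → (∀ i → T (v i) ≈ v i) →
                              FixedIndependent 1 v → FixedIndependent n v
    fixedPoints-independent {zero}  v Tv ind c fix eq ()
    fixedPoints-independent {suc d} v Tv ind c fix eq = go (c Fin.zero ≟ 0#)
      where
      ind-tail : FixedIndependent n (v ∘ Fin.suc)
      ind-tail = fixedPoints-independent (v ∘ Fin.suc) (Tv ∘ Fin.suc) (fixedIndependent-tail 1 v ind)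

      normalised : ∀ (e : Vector Carrier (suc d)) → e Fin.zero ≈ 1# → (∀ i → fr n (e i) ≈ e i) →
                   ¬ sum (λ i → e i ⊛ v i) ≈ 0#
      -- Once all coefficients are fixed by both powers they are fixed by x ↦ x^q, where
      -- independence is assumed; it makes the head 0, although it is 1.
      normalised e e₀≈1 fix-e rel = 0≉1 (trans (sym (ind e
        (λ i → fixed-coprime s n gcd≡1 (fix-s i) (fix-e i)) rel Fin.zero)) e₀≈1)
        where
        fix-s₀ : fr s (e Fin.zero) ≈ e Fin.zero
        fix-s₀ = trans (fr-cong s e₀≈1) (trans (fr-1 s) (sym e₀≈1))

        δ : Vector Carrier (suc d)
        δ i = fr s (e i) ⊕ - e i

        fix-δ : ∀ i → fr n (δ i) ≈ δ i
        fix-δ i = trans (additive n _ _) (+-cong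
          (trans (fr-comm s n (e i)) (fr-cong s (fix-e i)))
          (trans (fr-neg n (e i)) (-‿cong (fix-e i))))

        δ-rel : sum (λ i → δ (Fin.suc i) ⊛ v (Fin.suc i)) ≈ 0#
        δ-rel = begin
          sum (λ i → δ (Fin.suc i) ⊛ v (Fin.suc i))           ≈⟨ +-identityˡ _ ⟨
          0# ⊕ sum (λ i → δ (Fin.suc i) ⊛ v (Fin.suc i))
            ≈⟨ +-congʳ (trans (*-congʳ (+G.x≈y⇒x∙y⁻¹≈ε fix-s₀)) (zeroˡ _)) ⟨
          sum (λ i → δ i ⊛ v i)                               ≈⟨ +-identityʳ _ ⟨
          sum (λ i → δ i ⊛ v i) ⊕ 0#                          ≈⟨ +-congˡ rel ⟨
          sum (λ i → δ i ⊛ v i) ⊕ sum (λ i → e i ⊛ v i)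
            ≈⟨ ∑-distrib-+ (λ i → δ i ⊛ v i) (λ i → e i ⊛ v i) ⟨
          sum (λ i → δ i ⊛ v i ⊕ e i ⊛ v i)
            ≈⟨ sum-cong-≋ {n = suc d} (λ i → trans (sym (distribʳ (v i) (δ i) (e i)))
                 (*-congʳ (+G.//-rightDividesˡ (e i) (fr s (e i))))) ⟩
          sum (λ i → fr s (e i) ⊛ v i)                        ≈⟨ T-sum e v fix-e Tv ⟨
          T (sum (λ i → e i ⊛ v i))                           ≈⟨ trans (T-cong rel) T-0 ⟩
          0#                                                  ∎

        fix-s : ∀ i → fr s (e i) ≈ e i
        fix-s Fin.zero    = fix-s₀
        fix-s (Fin.suc i) = +G.x∙y⁻¹≈ε⇒x≈y _ _
          (ind-tail (δ ∘ Fin.suc) (fix-δ ∘ Fin.suc) δ-rel i)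

      go : Dec (c Fin.zero ≈ 0#) → ∀ i → c i ≈ 0#
      go (yes c₀≈0) Fin.zero    = c₀≈0
      go (yes c₀≈0) (Fin.suc i) = ind-tail (c ∘ Fin.suc) (fix ∘ Fin.suc)
        (trans (sym (trans (+-congʳ (trans (*-congʳ c₀≈0) (zeroˡ _))) (+-identityˡ _))) eq) i
      go (no c₀≉0) with invertible (c Fin.zero) c₀≉0
      ... | u , c₀u≈1 = contradiction
        (begin
          sum (λ i → u ⊛ c i ⊛ v i)
            ≈⟨ sum-cong-≋ {n = suc d} (λ i → *-assoc u (c i) (v i)) ⟩
          sum (λ i → u ⊛ (c i ⊛ v i))   ≈⟨ *-distribˡ-sum u (λ i → c i ⊛ v i) ⟨
          u ⊛ sum (λ i → c i ⊛ v i)     ≈⟨ trans (*-congˡ eq) (zeroʳ u) ⟩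
          0#                            ∎)
        (normalised (λ i → u ⊛ c i) (trans (*-comm u _) c₀u≈1) λ i →
          trans (fr-* n u (c i)) (*-cong (fixed-inverse n c₀u≈1 (fix Fin.zero)) (fix i)))

-- Residues mod t and the characteristic of K.

%≡%⇒≡[mod] : ∀ x y t .{{_ : NonZero t}} → x % t ≡ y % t → x ≡ y [mod t ]
%≡%⇒≡[mod] x y t eq = divides ∣ x / t - y / t ∣ (begin
  ∣ x - y ∣
    ≡⟨ ≡.cong₂ ∣_-_∣ (m≡m%n+[m/n]*n x t) (m≡m%n+[m/n]*n y t) ⟩
  ∣ x % t + x / t * t - y % t + y / t * t ∣
    ≡⟨ ≡.cong (λ r → ∣ r + x / t * t - y % t + y / t * t ∣) eq ⟩
  ∣ y % t + x / t * t - y % t + y / t * t ∣        ≡⟨ ℕ.∣m+n-m+o∣≡∣n-o∣ (y % t) _ _ ⟩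
  ∣ x / t * t - y / t * t ∣                        ≡⟨ ℕ.*-distribʳ-∣-∣ t (x / t) (y / t) ⟨
  ∣ x / t - y / t ∣ * t                            ∎)
  where open ≡.≡-Reasoning

%≡0⇒≡0[mod] : ∀ x t .{{_ : NonZero t}} → x % t ≡ 0 → x ≡ 0 [mod t ]
%≡0⇒≡0[mod] x t eq = ≡.subst (t ∣_) (≡.sym (ℕ.∣-∣-identityʳ x)) (m%n≡0⇒n∣m x t eq)

+-%≡⇒≡[mod] : ∀ s x y t .{{_ : NonZero t}} → (s + x) % t ≡ (s + y) % t → x ≡ y [mod t ]
+-%≡⇒≡[mod] s x y t eq = ≡.subst (t ∣_) (ℕ.∣m+n-m+o∣≡∣n-o∣ s x y) (%≡%⇒≡[mod] (s + x) (s + y) t eq)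

-- For h < n the bound (n - 1) l + s holds before reduction. For h = n the hypothesis t ≤ n l + s
-- lets t be subtracted once, which removes at least l because l < t.
residue-bound : ∀ n t s l .{{_ : NonZero t}} → 1 ≤ n → l ≤ t ∸ 1 → t ≤ n * l + s →
                ∀ h → h ≤ n → (s + h * l) % t ≤ (t ∸ 1) ⊓ ((n ∸ 1) * l + s)
residue-bound (suc n) t s l _ l≤t-1 t≤ h h≤n = ℕ.⊓-glb (ℕ.<⇒≤pred (m%n<n _ t)) (bound (h ℕ.≟ suc n))
  where
  open ℕ.≤-Reasoning
  t≤s+nl : t ≤ s + suc n * l
  t≤s+nl = ℕ.≤-trans t≤ (ℕ.≤-reflexive (ℕ.+-comm (suc n * l) s))
  rearrange : ∀ s l n → s + suc n * l ≡ l + (n * l + s)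
  rearrange = solve-∀
  bound : Dec (h ≡ suc n) → (s + h * l) % t ≤ n * l + s
  bound (yes ≡.refl) = begin
    (s + suc n * l) % t          ≡⟨ m≤n⇒[n∸m]%m≡n%m t≤s+nl ⟨
    (s + suc n * l ∸ t) % t      ≤⟨ m%n≤m _ t ⟩
    s + suc n * l ∸ t
      ≤⟨ ℕ.∸-monoʳ-≤ (s + suc n * l) (ℕ.≤-trans l≤t-1 (ℕ.m∸n≤m t 1)) ⟩
    s + suc n * l ∸ l            ≡⟨ ≡.cong (_∸ l) (rearrange s l n) ⟩
    l + (n * l + s) ∸ l          ≡⟨ ℕ.m+n∸m≡n l _ ⟩
    n * l + s                    ∎
  bound (no h≢) = begin
    (s + h * l) % t              ≤⟨ m%n≤m _ t ⟩
    s + h * l                    ≤⟨ ℕ.+-monoʳ-≤ s (ℕ.*-monoˡ-≤ l (ℕ.<⇒≤pred (ℕ.≤∧≢⇒< h≤n h≢))) ⟩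
    s + n * l                    ≡⟨ ℕ.+-comm s (n * l) ⟩
    n * l + s                    ∎

1<prime-power : ∀ {q} → IsPrimePower q → 1 < q
1<prime-power (p , suc e , p-prime , _ , ≡.refl) =
  ℕ.<-≤-trans (nonTrivial⇒n>1 p {{prime⇒nonTrivial p-prime}})
    (ℕ.m≤m*n p (p ^ e) {{ℕ.m^n≢0 p e {{prime⇒nonZero p-prime}}}})

prime-power-additive : ∀ {c ℓ q} → IsPrimePower q → ∀ m (K : FiniteField c ℓ (q ^ m)) →
                       FiniteFieldProperties.PowersAdditive K q
prime-power-additive (p , e , p-prime , _ , ≡.refl) m K k x y
  rewrite ℕ.^-*-assoc p e k = freshman-^ p-prime p×1≈0 (e * k) x y
  where
  open FiniteField K using (semiring; _≈_; 0#; 1#)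
  open FiniteFieldProperties K
  module × = SemiringMult semiring
  p×1≈0 : p ×.× 1# ≈ 0#
  p×1≈0 = p^k×1≈0⇒p×1≈0 p (e * m)
    (≡.subst (λ N → N ×.× 1# ≈ 0#) (ℕ.^-*-assoc p e m) order×1≈0)

-- The image of F in K as the solution set of x^q = x.

module _ {c₁ ℓ₁ c₂ ℓ₂ q N} {F : FiniteField c₁ ℓ₁ q} {K : FiniteField c₂ ℓ₂ N}
         (e : Embedding F K) where
  private
    module F = FiniteField F
    module +F = GroupProperties F.+-group
    module +K = GroupProperties (FiniteField.+-group K)
  open FiniteField K
    renaming (_+_ to infixl 6 _⊕_; _*_ to infixl 7 _⊛_; _^_ to infixr 8 _↑_)
  open Embedding e using (ι; isRingHomomorphism; leftModule)
  open RingMorphisms.IsRingHomomorphism isRingHomomorphism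
  open FiniteFieldProperties K
  open RootBound K
  open Combinations commutativeRing
  open SemiringSum semiring using (sum; sum-cong-≋)
  open RingProperties ring using (-1*x≈-x)
  open Inverse F.enumeration using (to-cong; from; strictlyInverseˡ)
  open SetoidReasoning setoid

  ι-nonzero : ∀ {x} → ¬ x F.≈ F.0# → ¬ ι x ≈ 0#
  ι-nonzero {x} x≉0 ιx≈0 with F.invertible x x≉0
  ... | u , xu≈1 = 0≉1 (begin
    0#             ≈⟨ zeroˡ (ι u) ⟨
    0# ⊛ ι u       ≈⟨ *-congʳ ιx≈0 ⟨
    ι x ⊛ ι u      ≈⟨ *-homo x u ⟨
    ι (x F.* u)    ≈⟨ ⟦⟧-cong xu≈1 ⟩
    ι F.1#         ≈⟨ 1#-homo ⟩
    1#             ∎)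

  ι-injective : ∀ {x y} → ι x ≈ ι y → x F.≈ y
  ι-injective {x} {y} ιx≈ιy with x F.≟ y
  ... | yes x≈y = x≈y
  ... | no x≉y = contradiction
    (trans (+-homo x (F.- y)) (trans (+-congˡ (-‿homo y)) (+K.x≈y⇒x∙y⁻¹≈ε ιx≈ιy)))
    (ι-nonzero (x≉y ∘ +F.x∙y⁻¹≈ε⇒x≈y x y))

  ι-^ : ∀ x n → ι (x F.^ n) ≈ ι x ↑ n
  ι-^ x zero    = 1#-homo
  ι-^ x (suc n) = trans (*-homo x _) (*-congˡ (ι-^ x n))

  -- Otherwise x^q - x would have q + 1 roots.
  x^q≈x⇒x∈ι : 1 < q → ∀ {x} → x ↑ q ≈ x → ∃[ y ] ι y ≈ x
  x^q≈x⇒x∈ι 1<q {x} x^q≈x with Fin.any? (λ i → ι (from i) ≟ x)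
  ... | yes (i , eq) = from i , eq
  ... | no x∉ι = contradiction
    (unique-exponent⇒zero (distinct⇒unisolvent (suc q) ℕ.≤-refl roots distinct)
      coeffs exps (λ { Fin.zero → ℕ.n<1+n q ; (Fin.suc Fin.zero) → ℕ.m<n⇒m<1+n 1<q })
      vanish Fin.zero
      (λ { Fin.zero 0≢0 _ → 0≢0 ≡.refl ; (Fin.suc Fin.zero) _ 1≡q → ℕ.<⇒≢ 1<q 1≡q }))
    (0≉1 ∘ sym)
    where
    roots : Vector Carrier (suc q)
    roots = x Vector.∷ (ι ∘ from)

    -- The polynomial x^q - x; since 1 < q its leading exponent is unshared.
    coeffs : Vector Carrier 2
    coeffs = 1# Vector.∷ λ _ → - 1#

    exps : Vector ℕ 2
    exps = q Vector.∷ λ _ → 1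

    distinct : ∀ i j → i ≢ j → ¬ roots i ≈ roots j
    distinct Fin.zero    Fin.zero    i≢j = contradiction ≡.refl i≢j
    distinct Fin.zero    (Fin.suc j) _ eq = x∉ι (j , sym eq)
    distinct (Fin.suc i) Fin.zero    _ eq = x∉ι (i , eq)
    distinct (Fin.suc i) (Fin.suc j) i≢j eq = i≢j (≡.cong Fin.suc
      (≡.trans (≡.sym (strictlyInverseˡ i)) (≡.trans (to-cong (ι-injective eq)) (strictlyInverseˡ j))))

    root^q : ∀ i → roots i ↑ q ≈ roots i
    root^q Fin.zero    = x^q≈x
    root^q (Fin.suc i) = trans (sym (ι-^ (from i) q))
      (⟦⟧-cong (FiniteFieldProperties.x^order≈x F (from i)))

    vanish : ∀ i → sum (λ k → coeffs k ⊛ roots i ↑ exps k) ≈ 0#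
    vanish i = begin
      1# ⊛ roots i ↑ q ⊕ (- 1# ⊛ roots i ↑ 1 ⊕ 0#)
        ≈⟨ +-cong (trans (*-identityˡ _) (root^q i))
                  (trans (+-identityʳ _) (trans (-1*x≈-x _) (-‿cong (*-identityʳ _)))) ⟩
      roots i ⊕ - roots i    ≈⟨ -‿inverseʳ _ ⟩
      0#                     ∎

  -- Coefficients with c^q = c pull back along `ι`, so a relation over the fixed field is a relation
  -- over F.
  independent⇒fixedIndependent : 1 < q →
    (additive : PowersAdditive q) →
    ∀ {d} (v : Vector Carrier d) → LinearlyIndependent leftModule v →
    Frobenius.FixedIndependent K q additive 1 v
  independent⇒fixedIndependent 1<q additive {d} v ind c fix rel i =
    trans (sym (proj₂ (preimage i))) (trans (⟦⟧-cong (ind (proj₁ ∘ preimage)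
      (trans (sum-cong-≋ {n = d} (λ i → *-congʳ (proj₂ (preimage i)))) rel) i)) 0#-homo)
    where
    preimage : ∀ i → ∃[ y ] ι y ≈ c i
    preimage i = x^q≈x⇒x∈ι 1<q (≡.subst (λ m → c i ↑ m ≈ c i) (ℕ.*-identityʳ q) (fix i))

-- The semilinear map T and its iterates.

module Trinomial {c ℓ} (q n t s l : ℕ) .{{_ : NonZero t}} (K : FiniteField c ℓ (q ^ (n * t)))
                 (additive : FiniteFieldProperties.PowersAdditive K q)
                 (a b : FiniteField.Carrier K)
                 (a≉0 : ¬ FiniteField._≈_ K a (FiniteField.0# K))
                 (b≉0 : ¬ FiniteField._≈_ K b (FiniteField.0# K)) where

  open FiniteField K
    renaming (_+_ to infixl 6 _⊕_; _*_ to infixl 7 _⊛_; _^_ to infixr 8 _↑_)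
  open Frobenius K q additive
  open FiniteFieldProperties K
  open Combinations commutativeRing
  open SemiringSum semiring using (sum; sum-cong-≋; *-distribˡ-sum; ∑-distrib-+; sum-init-last)
  open SemiringSolver commutativeSemiring using (solve; _:=_; _:+_; _:*_)
  open RingProperties ring using (-1*x≈-x)
  open GroupProperties +-group using (inverseˡ-unique; ⁻¹-injective; ε⁻¹≈ε)
  open SetoidReasoning setoid

  private
    regroup-+ : ∀ a b x y z w → a ⊛ (x ⊕ y) ⊕ b ⊛ (z ⊕ w) ≈ a ⊛ x ⊕ b ⊛ z ⊕ (a ⊛ y ⊕ b ⊛ w)
    regroup-+ = solve 6 (λ a b x y z w →
      a :* (x :+ y) :+ b :* (z :+ w) := a :* x :+ b :* z :+ (a :* y :+ b :* w)) refl

    regroup-* : ∀ a b c x y → a ⊛ (c ⊛ x) ⊕ b ⊛ (c ⊛ y) ≈ c ⊛ (a ⊛ x ⊕ b ⊛ y)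
    regroup-* = solve 5 (λ a b c x y → a :* (c :* x) :+ b :* (c :* y) := c :* (a :* x :+ b :* y)) refl

    solve-neg : ∀ x y z → - x ⊕ y ⊕ z ≈ 0# → y ⊕ z ≈ x
    solve-neg x y z eq =
      ⁻¹-injective (sym (inverseˡ-unique (- x) (y ⊕ z) (trans (sym (+-assoc (- x) y z)) eq)))

  T : Carrier → Carrier
  T x = a ⊛ fr s x ⊕ b ⊛ fr (s + l * n) x

  T-cong : ∀ {x y} → x ≈ y → T x ≈ T y
  T-cong eq = +-cong (*-congˡ (fr-cong s eq)) (*-congˡ (fr-cong (s + l * n) eq))

  T-+ : ∀ x y → T (x ⊕ y) ≈ T x ⊕ T y
  T-+ x y = trans (+-cong (*-congˡ (additive s x y)) (*-congˡ (additive (s + l * n) x y)))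
    (regroup-+ a b _ _ _ _)

  -- The two exponents of T differ by l n, which acts trivially on elements fixed by φ; both terms
  -- therefore twist c by σ.
  T-* : ∀ {c} x → fr n c ≈ c → T (c ⊛ x) ≈ fr s c ⊛ T x
  T-* {c} x fix = trans
    (+-cong (*-congˡ (fr-* s c x)) (*-congˡ (trans (fr-* (s + l * n) c x) (*-congʳ fr-c))))
    (regroup-* a b (fr s c) (fr s x) (fr (s + l * n) x))
    where
    fr-c : fr (s + l * n) c ≈ fr s c
    fr-c = trans (sym (fr-fr s (l * n) c))
      (trans (fr-comm s (l * n) c) (fr-cong s (fixed-multiple n fix l)))

  Ker⇒fixed : ∀ x → Ker K (trinomial K q n s l a b) x → T x ≈ x
  Ker⇒fixed x = solve-neg x _ _

  -- T^k x is the sum over h ≤ k of γ k h x^(q^(k s + h l n)).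
  private
    A B γ : ℕ → ℕ → Carrier
    A k h       = a ⊛ fr s (γ k h)
    B k zero    = 0#
    B k (suc h) = b ⊛ fr (s + l * n) (γ k h)
    γ zero    zero    = 1#
    γ zero    (suc h) = 0#
    γ (suc k) h       = A k h ⊕ B k h

  γ-above : ∀ {k h} → k < h → γ k h ≈ 0#
  γ-above {zero}  {suc h} _         = refl
  γ-above {suc k} {suc h} (s≤s k<h) = begin
    a ⊛ fr s (γ k (suc h)) ⊕ b ⊛ fr (s + l * n) (γ k h)
      ≈⟨ +-cong (*-congˡ (fr-cong s (γ-above (ℕ.m<n⇒m<1+n k<h))))
                (*-congˡ (fr-cong (s + l * n) (γ-above k<h))) ⟩
    a ⊛ fr s 0# ⊕ b ⊛ fr (s + l * n) 0#
      ≈⟨ +-cong (trans (*-congˡ (fr-0 s)) (zeroʳ a)) (trans (*-congˡ (fr-0 (s + l * n))) (zeroʳ b)) ⟩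
    0# ⊕ 0#    ≈⟨ +-identityˡ 0# ⟩
    0#         ∎

  A-above : ∀ k → A k (suc k) ≈ 0#
  A-above k = trans (*-congˡ (trans (fr-cong s (γ-above (ℕ.n<1+n k))) (fr-0 s))) (zeroʳ a)

  -- Only the choice of the `a` term at every iteration reaches h = 0, giving a product of Frobenius
  -- images of `a`.
  γ-first-nonzero : ∀ k → ¬ γ k 0 ≈ 0#
  γ-first-nonzero zero    1≈0 = 0≉1 (sym 1≈0)
  γ-first-nonzero (suc k) eq  = *-nonzero a≉0 (^-nonzero (q ^ s) (γ-first-nonzero k))
    (trans (sym (+-identityʳ _)) eq)

  -- Dually, h = k arises only from choosing the `b` term every time.
  γ-last-nonzero : ∀ k → ¬ γ k k ≈ 0#
  γ-last-nonzero zero    1≈0 = 0≉1 (sym 1≈0)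
  γ-last-nonzero (suc k) eq  = *-nonzero b≉0 (^-nonzero (q ^ (s + l * n)) (γ-last-nonzero k))
    (trans (sym (trans (+-congʳ (A-above k)) (+-identityˡ _))) eq)

  private
    -- The Frobenius power common to all terms of an iterate is absorbed in `y`, leaving exponents h
    -- l n.
    at : (ℕ → Carrier) → Carrier → ℕ → Carrier
    at D y h = D h ⊛ fr (h * (l * n)) y

  fr-expansion : ∀ k D {m} y → fr k (sum {m} (at D y ∘ toℕ)) ≈ sum {m} (at (fr k ∘ D) (fr k y) ∘ toℕ)
  fr-expansion k D {m} y = trans (fr-sum k {m} (at D y ∘ toℕ)) (sum-cong-≋ {n = m} λ i →
    trans (fr-* k (D (toℕ i)) (fr (toℕ i * (l * n)) y)) (*-congˡ (fr-comm (toℕ i * (l * n)) k y)))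

  -- A Pascal-type recursion: the `a` part keeps h and is padded by a zero last term, while the `b`
  -- part raises h by one and is padded by a zero first term.
  T-expansion : ∀ k y →
    T (sum {suc k} (at (γ k) y ∘ toℕ)) ≈ sum {suc (suc k)} (at (γ (suc k)) (fr s y) ∘ toℕ)
  T-expansion k y = begin
    T (sum {suc k} (at (γ k) y ∘ toℕ))
      ≈⟨ +-cong low high ⟩
    sum {suc (suc k)} (at (A k) z ∘ toℕ) ⊕ sum {suc (suc k)} (at (B k) z ∘ toℕ)
      ≈⟨ ∑-distrib-+ {suc (suc k)} (at (A k) z ∘ toℕ) (at (B k) z ∘ toℕ) ⟨
    sum {suc (suc k)} (λ i → at (A k) z (toℕ i) ⊕ at (B k) z (toℕ i))
      ≈⟨ sum-cong-≋ {n = suc (suc k)} (λ i →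
           sym (distribʳ (fr (toℕ i * (l * n)) z) (A k (toℕ i)) (B k (toℕ i)))) ⟩
    sum {suc (suc k)} (at (γ (suc k)) z ∘ toℕ) ∎
    where
    z = fr s y

    last≈0 : at (A k) z (toℕ (fromℕ (suc k))) ≈ 0#
    last≈0 = trans (reflexive (≡.cong (at (A k) z) (Fin.toℕ-fromℕ (suc k))))
      (trans (*-congʳ (A-above k)) (zeroˡ _))

    low : a ⊛ fr s (sum {suc k} (at (γ k) y ∘ toℕ)) ≈ sum {suc (suc k)} (at (A k) z ∘ toℕ)
    low = begin
      a ⊛ fr s (sum {suc k} (at (γ k) y ∘ toℕ))
        ≈⟨ *-congˡ (fr-expansion s (γ k) {suc k} y) ⟩
      a ⊛ sum {suc k} (at (fr s ∘ γ k) z ∘ toℕ)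
        ≈⟨ *-distribˡ-sum {suc k} a (at (fr s ∘ γ k) z ∘ toℕ) ⟩
      sum {suc k} (λ i → a ⊛ at (fr s ∘ γ k) z (toℕ i))
        ≈⟨ sum-cong-≋ {n = suc k} (λ i → trans
             (sym (*-assoc a (fr s (γ k (toℕ i))) (fr (toℕ i * (l * n)) z)))
             (reflexive (≡.cong (at (A k) z) (≡.sym (Fin.toℕ-inject₁ i))))) ⟩
      sum {suc k} (at (A k) z ∘ toℕ ∘ inject₁)
        ≈⟨ trans (+-congˡ last≈0) (+-identityʳ _) ⟨
      sum {suc k} (at (A k) z ∘ toℕ ∘ inject₁) ⊕ at (A k) z (toℕ (fromℕ (suc k)))
        ≈⟨ sum-init-last {suc k} (at (A k) z ∘ toℕ) ⟨
      sum {suc (suc k)} (at (A k) z ∘ toℕ) ∎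

    shift : ∀ h → fr (h * (l * n)) (fr (s + l * n) y) ≈ fr (suc h * (l * n)) z
    shift h = begin
      fr (h * (l * n)) (fr (s + l * n) y)        ≈⟨ fr-cong (h * (l * n)) (fr-fr s (l * n) y) ⟨
      fr (h * (l * n)) (fr (l * n) z)            ≈⟨ fr-fr (l * n) (h * (l * n)) z ⟩
      fr (l * n + h * (l * n)) z                 ∎

    high : b ⊛ fr (s + l * n) (sum {suc k} (at (γ k) y ∘ toℕ)) ≈ sum {suc (suc k)} (at (B k) z ∘ toℕ)
    high = begin
      b ⊛ fr (s + l * n) (sum {suc k} (at (γ k) y ∘ toℕ))
        ≈⟨ *-congˡ (fr-expansion (s + l * n) (γ k) {suc k} y) ⟩
      b ⊛ sum {suc k} (at (fr (s + l * n) ∘ γ k) (fr (s + l * n) y) ∘ toℕ)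
        ≈⟨ *-distribˡ-sum {suc k} b (at (fr (s + l * n) ∘ γ k) (fr (s + l * n) y) ∘ toℕ) ⟩
      sum {suc k} (λ i → b ⊛ at (fr (s + l * n) ∘ γ k) (fr (s + l * n) y) (toℕ i))
        ≈⟨ sum-cong-≋ {n = suc k} (λ i → trans
             (sym (*-assoc b (fr (s + l * n) (γ k (toℕ i))) (fr (toℕ i * (l * n)) (fr (s + l * n) y))))
             (*-congˡ (shift (toℕ i)))) ⟩
      sum {suc k} (at (B k) z ∘ suc ∘ toℕ)
        ≈⟨ trans (+-congʳ (zeroˡ (fr 0 z))) (+-identityˡ _) ⟨
      sum {suc (suc k)} (at (B k) z ∘ toℕ) ∎

  fixed-expansion : ∀ k {x} → T x ≈ x → x ≈ sum {suc k} (at (γ k) (fr (k * s) x) ∘ toℕ)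
  fixed-expansion zero {x} Tx≈x = sym (begin
    1# ⊛ fr 0 (fr 0 x) ⊕ 0#   ≈⟨ trans (+-identityʳ _) (*-identityˡ _) ⟩
    fr 0 (fr 0 x)             ≈⟨ trans (*-identityʳ _) (*-identityʳ x) ⟩
    x                         ∎)
  fixed-expansion (suc k) {x} Tx≈x = begin
    x                                                        ≈⟨ Tx≈x ⟨
    T x
      ≈⟨ T-cong (fixed-expansion k Tx≈x) ⟩
    T (sum {suc k} (at (γ k) (fr (k * s) x) ∘ toℕ))          ≈⟨ T-expansion k (fr (k * s) x) ⟩
    sum {suc (suc k)} (at (γ (suc k)) (fr s (fr (k * s) x)) ∘ toℕ)
      ≈⟨ sum-cong-≋ {n = suc (suc k)} (λ i → *-congˡ {x = γ (suc k) (toℕ i)} (fr-cong (toℕ i * (l * n))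
           (trans (fr-comm (k * s) s x) (fr-fr s (k * s) x)))) ⟩
    sum {suc (suc k)} (at (γ (suc k)) (fr (suc k * s) x) ∘ toℕ) ∎

  -- φ^t is the identity, since K has q^(n t) elements.
  fr-% : ∀ m x → fr (m * n) x ≈ fr (m % t * n) x
  fr-% m x = begin
    fr (m * n) x
      ≈⟨ fr-exp x (≡.trans (≡.cong (_* n) (m≡m%n+[m/n]*n m t))
           (expand (m % t) (m / t) t n)) ⟩
    fr (m % t * n + m / t * (n * t)) x                ≈⟨ fr-fr (m % t * n) (m / t * (n * t)) x ⟨
    fr (m / t * (n * t)) (fr (m % t * n) x)
      ≈⟨ fixed-multiple (n * t) (x^order≈x (fr (m % t * n) x)) (m / t) ⟩
    fr (m % t * n) x                                  ∎
    where
    expand : ∀ r k t n → (r + k * t) * n ≡ r * n + k * (n * t)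
    expand = solve-∀

  -- Bounds on the number of independent fixed points.

  module _ {d} (v : Vector Carrier d) (independent : FixedIndependent n v) where

    independent⇒d≤t : 1 ≤ t → d ≤ t
    independent⇒d≤t 1≤t = ℕ.≮⇒≥ λ t<d → 0≉1 (sym
      (unique-exponent⇒zero (independent⇒unisolvent n (suc t) t<d v independent)
        (1# Vector.∷ λ _ → - 1#) exps
        (λ { Fin.zero → ℕ.n<1+n t ; (Fin.suc Fin.zero) → s≤s z≤n })
        vanish Fin.zero
        (λ { Fin.zero 0≢0 _ → 0≢0 ≡.refl ; (Fin.suc Fin.zero) _ 0≡t → ℕ.<⇒≢ 1≤t 0≡t })))
      where
      exps : Vector ℕ 2
      exps = t Vector.∷ λ _ → 0

      vanish : ∀ i → 1# ⊛ fr (t * n) (v i) ⊕ (- 1# ⊛ fr 0 (v i) ⊕ 0#) ≈ 0#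
      vanish i = begin
        1# ⊛ fr (t * n) (v i) ⊕ (- 1# ⊛ fr 0 (v i) ⊕ 0#)
          ≈⟨ +-cong (trans (*-identityˡ _) (trans (fr-exp (v i) (ℕ.*-comm t n)) (x^order≈x (v i))))
                    (trans (+-identityʳ _) (trans (-1*x≈-x _) (-‿cong (*-identityʳ (v i))))) ⟩
        v i ⊕ - v i    ≈⟨ -‿inverseʳ (v i) ⟩
        0#             ∎

    -- The terms of T^n x - x, with exponents of x ↦ x^(q^n) reduced mod t.
    exps : Vector ℕ (suc (suc n))
    exps = 0 Vector.∷ λ h → (s + toℕ h * l) % t

    coeffs : Vector Carrier (suc (suc n))
    coeffs = - 1# Vector.∷ λ h → γ n (toℕ h)

    module _ (fixed : ∀ i → T (v i) ≈ v i) where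

      vanish : ∀ i → sum (λ k → coeffs k ⊛ fr (exps k * n) (v i)) ≈ 0#
      vanish i = begin
        - 1# ⊛ fr 0 x ⊕ sum {suc n} (λ h → γ n (toℕ h) ⊛ fr ((s + toℕ h * l) % t * n) x)
          ≈⟨ +-cong (trans (-1*x≈-x _) (-‿cong (*-identityʳ x)))
                    (sum-cong-≋ {n = suc n} (λ h → *-congˡ {x = γ n (toℕ h)} (exponent (toℕ h)))) ⟩
        - x ⊕ sum {suc n} (at (γ n) (fr (n * s) x) ∘ toℕ)
          ≈⟨ +-congˡ (fixed-expansion n (fixed i)) ⟨
        - x ⊕ x
          ≈⟨ -‿inverseˡ x ⟩
        0# ∎
        where
        x = v i
        expand : ∀ s h l n → (s + h * l) * n ≡ n * s + h * (l * n)
        expand = solve-∀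
        exponent : ∀ h → fr ((s + h * l) % t * n) x ≈ fr (h * (l * n)) (fr (n * s) x)
        exponent h = begin
          fr ((s + h * l) % t * n) x           ≈⟨ fr-% (s + h * l) x ⟨
          fr ((s + h * l) * n) x               ≈⟨ fr-exp x (expand s h l n) ⟩
          fr (n * s + h * (l * n)) x           ≈⟨ fr-fr (n * s) (h * (l * n)) x ⟨
          fr (h * (l * n)) (fr (n * s) x)      ∎

      unique-exponent⇒d<m : ∀ {m} → (∀ k → exps k < m) →
        ∀ k → ¬ coeffs k ≈ 0# → (∀ k′ → k′ ≢ k → exps k′ ≢ exps k) → d < m
      unique-exponent⇒d<m {m} exps<m k γ≉0 unique = ℕ.≰⇒> λ m≤d → γ≉0
        (unique-exponent⇒zero (independent⇒unisolvent n m m≤d v independent)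
          coeffs exps exps<m vanish k unique)

      -1≉0 : ¬ - 1# ≈ 0#
      -1≉0 -1≈0 = 0≉1 (sym (⁻¹-injective (trans -1≈0 (sym ε⁻¹≈ε))))

      -- Each alternative singles out one term whose exponent occurs only once: the
      -- term -x, the term with h = 0, and the term with h = n, respectively.
      condition⇒d<m :
        (∀ h → h ≤ n → ¬ (s + h * l ≡ 0 [mod t ]))
        ⊎ ((∀ j → 1 ≤ j → j ≤ n → ¬ (j * l ≡ 0 [mod t ])) × ¬ (s ≡ 0 [mod t ]))
        ⊎ ((∀ i → i ≤ n ∸ 1 → ¬ (l * n ≡ i * l [mod t ])) × ¬ (s + l * n ≡ 0 [mod t ])) →
        ∀ {m} → (∀ k → exps k < m) → d < m
      condition⇒d<m (inj₁ s+hl≢0) exps<m = unique-exponent⇒d<m exps<m Fin.zero -1≉0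
        λ { Fin.zero 0≢0 _ → 0≢0 ≡.refl
          ; (Fin.suc h) _ eq → s+hl≢0 (toℕ h) (Fin.toℕ≤pred[n] h) (%≡0⇒≡0[mod] (s + toℕ h * l) t eq) }
      condition⇒d<m (inj₂ (inj₁ (jl≢0 , s≢0))) exps<m =
        -- Index 0 holds the term -x, so the term of T^n with parameter h sits at `Fin.suc h`.
        -- Comparing it with h = 0 cancels s and leaves j l ≡ 0.
        unique-exponent⇒d<m exps<m (Fin.suc Fin.zero) (γ-first-nonzero n)
        λ { Fin.zero _ eq →
              s≢0 (≡.subst (_≡ 0 [mod t ]) (ℕ.+-identityʳ s) (%≡0⇒≡0[mod] (s + 0) t (≡.sym eq)))
          ; (Fin.suc Fin.zero) 1≢1 _ → 1≢1 ≡.refl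
          ; (Fin.suc (Fin.suc h)) _ eq →
              jl≢0 (suc (toℕ h)) (s≤s z≤n) (Fin.toℕ<n h) (+-%≡⇒≡[mod] s (suc (toℕ h) * l) 0 t eq) }
      condition⇒d<m (inj₂ (inj₂ (ln≢il , s+ln≢0))) exps<m =
        unique-exponent⇒d<m exps<m (Fin.suc (fromℕ n))
        (≡.subst (λ h → ¬ γ n h ≈ 0#) (≡.sym (Fin.toℕ-fromℕ n)) (γ-last-nonzero n))
        λ { Fin.zero _ eq → s+ln≢0 (%≡0⇒≡0[mod] (s + l * n) t (≡.trans (≡.sym last) (≡.sym eq)))
          ; (Fin.suc h) h≢n eq → ln≢il (toℕ h)
              (ℕ.<⇒≤pred (ℕ.≤∧≢⇒< (Fin.toℕ≤pred[n] h) λ h≡n → h≢n (≡.cong Fin.suc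
                (Fin.toℕ-injective (≡.trans h≡n (≡.sym (Fin.toℕ-fromℕ n)))))))
              (+-%≡⇒≡[mod] s (l * n) (toℕ h * l) t (≡.trans (≡.sym last) (≡.sym eq))) }
        where
        last : (s + toℕ (fromℕ n) * l) % t ≡ (s + l * n) % t
        last = ≡.cong (λ x → (s + x) % t)
          (≡.trans (≡.cong (_* l) (Fin.toℕ-fromℕ n)) (ℕ.*-comm n l))

-- The kernel dimension.

theorem4p1 : ∀ {c₁ ℓ₁ c₂ ℓ₂} (q n t s l : ℕ) →
    IsPrimePower q →
    1 ≤ n → 1 ≤ t → 1 ≤ s → 1 ≤ l →
    gcd s n ≡ 1 →
    l ≤ t ∸ 1 →
    (F : FiniteField c₁ ℓ₁ q) (K : FiniteField c₂ ℓ₂ (q ^ (n * t))) →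
    (e : Embedding F K) →
    (a b : FiniteField.Carrier K) →
    ¬ (FiniteField._≈_ K a (FiniteField.0# K)) →
    ¬ (FiniteField._≈_ K b (FiniteField.0# K)) →
    (d : ℕ) →
    HasDimension (Embedding.leftModule e) (Ker K (trinomial K q n s l a b)) d →
    (d ≤ t)
    × (t ≤ n * l + s →
    (∀ h → h ≤ n → ¬ (s + h * l ≡ 0 [mod t ]))
    ⊎ ((∀ j → 1 ≤ j → j ≤ n → ¬ (j * l ≡ 0 [mod t ]))
    × ¬ (s ≡ 0 [mod t ]))
    ⊎ ((∀ i → i ≤ n ∸ 1 → ¬ (l * n ≡ i * l [mod t ]))
    × ¬ (s + l * n ≡ 0 [mod t ])) →
    d ≤ (t ∸ 1) ⊓ ((n ∸ 1) * l + s))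
theorem4p1 q n t@(suc _) s l q-pp 1≤n 1≤t _ _ gcd≡1 l≤t-1 F K e a b a≉0 b≉0 d (v , basis) =
  independent⇒d≤t v independent 1≤t , λ t≤nl+s condition →
    -- The number m of admissible exponents is one more than the minimum, because exponents start at
    -- 0; d < m is then the claimed bound.
    ℕ.≤-pred (condition⇒d<m v independent fixed condition
      λ { Fin.zero    → s≤s z≤n
        ; (Fin.suc h) → s≤s (residue-bound n t s l 1≤n l≤t-1 t≤nl+s (toℕ h) (Fin.toℕ≤pred[n] h)) })
  where
  additive = prime-power-additive q-pp (n * t) K
  open Trinomial q n t s l K additive a b a≉0 b≉0
  open Frobenius K q additive using (FixedIndependent; fixedPoints-independent)
  open FiniteField K using (_≈_)

  fixed : ∀ i → T (v i) ≈ v i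
  fixed i = Ker⇒fixed (v i) (IsBasis.members basis i)

  independent : FixedIndependent n v
  independent = fixedPoints-independent s n gcd≡1 T T-cong T-+ T-* v fixed
    (independent⇒fixedIndependent e (1<prime-power q-pp) additive v (IsBasis.independent basis))
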